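{- Let $p>3$ be a prime, let $a\in\mathbb{Z}_p$ with $a\not\equiv 0\pmod p$, let $\langle a\rangle_p$ be the least nonnegative residue of $a$ modulo $p$, and let $t=(a-\langle a\rangle_p)/p$. Then $$\sum_{k=0}^{(p-1)/2}\binom ak\binom{ -1-a}k\equiv\begin{cases}\sum_{k=0}^{p-1}\binom ak(-2)^k\pmod{p^2}&\text{if }\langle a\rangle_p\le\frac{p-1}2,\\ \big(1+\frac1t\big)\sum_{k=0}^{p-1}\binom ak(-2)^k-(-1)^{\langle a\rangle_p}\frac1t\pmod{p^2}&\text{if }\langle a\rangle_p>\frac{p-1}2\text{ and }t\not\equiv0\pmod p,\\ (-1)^{\langle a\rangle_p}-pE_{p-2}(-a)\pmod{p^2}&\text{if }\langle a\rangle_p>\frac{p-1}2\text{ and }t\equiv0\pmod p.\end{cases}$$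
   Context: $\mathbb{Z}_p$ denotes the set of rational numbers whose denominator is not divisible by $p$; congruences modulo $p^m$ are taken in $\mathbb{Z}_p$ (i.e. $x\equiv y$ means $x-y\in p^m\mathbb{Z}_p$). For $a\in\mathbb{Z}_p$, $\langle a\rangle_p\in\{0,1,\dots,p-1\}$ satisfies $\langle a\rangle_p\equiv a\pmod p$. $\binom xk=x(x-1)\cdots(x-k+1)/k!$. The Euler numbers are defined by $E_0=1$, $E_n=-\sum_{k=1}^{[n/2]}\binom n{2k}E_{n-2k}$ ($n\ge1$), and the Euler polynomials by $E_n(x)=2^{ -n}\sum_{r=0}^n\binom nr(2x-1)^{n-r}E_r$. -}

module Defs where

open import Data.Nat as ℕ using (ℕ; zero; suc; _∸_)
open import Data.Nat.Divisibility using (_∣_)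
open import Data.Nat.Combinatorics using (_C_)
open import Data.Nat.Base using (_!)
open import Data.Integer as ℤ using (ℤ; +_; -[1+_])
open import Data.Rational using (ℚ; mkℚ; 0ℚ; 1ℚ; _+_; _*_; _-_; -_; 1/_; ↥_; ↧ₙ_)
open import Data.List using (List; foldr; map; upTo)
open import Data.Product using (∃; _×_)
open import Relation.Binary.PropositionalEquality using (_≡_)
open import Relation.Nullary using (¬_)

ℕ→ℚ : ℕ → ℚ
ℕ→ℚ n = (+ n) Q./ 1
  where import Data.Rational as Q

-- total multiplicative inverse (0 ↦ 0); only applied to nonzero arguments
inv : ℚ → ℚ
inv (mkℚ (+ zero) _ _) = 0ℚ
inv q@(mkℚ (+ suc n) _ _) = 1/ q
inv q@(mkℚ -[1+ n ] _ _) = 1/ q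

_^_ : ℚ → ℕ → ℚ
x ^ zero = 1ℚ
x ^ suc n = x * (x ^ n)

sumℚ : List ℚ → ℚ
sumℚ = foldr _+_ 0ℚ

sum0to : ℕ → (ℕ → ℚ) → ℚ
sum0to n f = sumℚ (map f (upTo (suc n)))

sum1to : ℕ → (ℕ → ℚ) → ℚ
sum1to n f = sumℚ (map (λ k → f (suc k)) (upTo n))

prodℚ : ℕ → (ℕ → ℚ) → ℚ
prodℚ zero f = 1ℚ
prodℚ (suc n) f = prodℚ n f * f n

binom : ℚ → ℕ → ℚ
binom x k = prodℚ k (λ i → x - ℕ→ℚ i) * inv (ℕ→ℚ (k !))

Zp : ℕ → ℚ → Set
Zp p x = ¬ (p ∣ ↧ₙ x)

Cong : ℕ → ℕ → ℚ → ℚ → Set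
Cong p m x y = ∃ λ z → Zp p z × (x - y ≡ (ℕ→ℚ p ^ m) * z)

-- Euler numbers, via a fuel argument (fuel n+1 suffices for E_n)
E' : ℕ → ℕ → ℚ
E' zero n = 0ℚ
E' (suc f) zero = 1ℚ
E' (suc f) (suc m) =
  - sum1to (suc m ℕ./ 2) (λ k → ℕ→ℚ (suc m C (2 ℕ.* k)) * E' f (suc m ∸ 2 ℕ.* k))

eulerNumber : ℕ → ℚ
eulerNumber n = E' (suc n) n

eulerPoly : ℕ → ℚ → ℚ
eulerPoly n x = inv (ℕ→ℚ 2 ^ n) *
  sum0to n (λ r → ℕ→ℚ (n C r) * (((ℕ→ℚ 2 * x) - 1ℚ) ^ (n ∸ r)) * eulerNumber r)

{-# OPTIONS --safe #-}

-- Write L(a) and S(a) for the two sums, polynomials in a over ℤₚ of degree < p, and h = (p-1)/2.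
-- Telescoping gives L(a) + L(a+1) = 2·C(a,h)·C(-2-a,h) and S(a) + S(a+1) = 2·(-2)ᵖ⁻¹·C(a,p-1),
-- hence L(n) = (-1)ⁿ for 0 ≤ n ≤ h and S(n) = (-1)ⁿ for 0 ≤ n < p; the symmetry L(-1-a) = L(a)
-- yields L(n-p) = (-1)ⁿ for h < n < p.  So L and S agree mod p at 0, …, p-1, and Newton interpolation
-- gives L = S + p·R with R over ℤₚ: L - S is constant mod p² on residue classes mod p.
-- If r ≤ h, compare a = r + pt with r.  If r > h, compare a with r - p, and eliminate the
-- derivative of S at r between S(r + pt) and S(r - p).
-- When p ∣ t, the same interpolation argument gives S(a) = 1 - Eₚ₋₁(-a) + p·R(a), so that
-- S(r) - S(r-p) ≡ Eₚ₋₁(-r+p) - Eₚ₋₁(-r) ≡ p(p-1)·Eₚ₋₂(-r) (mod p²).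
module Submission where

open import Defs
open import Data.Integer as ℤ using (-[1+_])
open import Data.Integer.GCD using (gcd)
import Data.Integer.Properties as ℤP
open import Data.List using (applyUpTo; upTo)
open import Data.List.Properties using (map-cong; map-upTo)
open import Data.Nat as ℕ using (ℕ; zero; suc; _<_; _≤_; _>_; z≤n; s≤s; _∸_; _!)
open import Data.Nat.Combinatorics using (_C_; nCk+nC[k+1]≡[n+1]C[k+1]; k>n⇒nCk≡0; nCn≡1)
import Data.Nat.Coprimality as C
open import Data.Nat.DivMod using (+-distrib-/-∣ˡ; m≡m%n+[m/n]*n; m%n<n)
open import Data.Nat.Divisibility using (_∣_; ∣1⇒≡1; ∣-refl; ∣-trans; ∣⇒≤; divides)
open import Data.Nat.Primality using (Prime; euclidsLemma; ¬prime[1]; prime⇒irreducible; prime⇒nonZero)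
import Data.Nat.Properties as ℕP
open import Data.Product using (∃; _×_; _,_)
open import Data.Rational using (ℚ; mkℚ; 0ℚ; 1ℚ; _+_; _*_; _-_; -_; ↥_; ↧_; ↧ₙ_; _/_)
import Data.Rational.Properties as ℚP
open import Data.Rational.Unnormalised using (mkℚᵘ; *≡*)
open import Data.Sum using (inj₁; inj₂; [_,_]′)
open import Function using (_∘_)
open import Level using (0ℓ)
open import Relation.Binary.PropositionalEquality
open import Relation.Nullary using (¬_; yes; no; contradiction)
open import Relation.Nullary.Decidable.Core using (dec⇒maybe)
open import Tactic.RingSolver using (solve-∀)
open import Tactic.RingSolver.Core.AlmostCommutativeRing using (AlmostCommutativeRing; fromCommutativeRing)
open ≡-Reasoning

-- Rational arithmetic

-- Interpolation at 0, ..., p-1 divides only by 1, ..., p-1, all units of ℤₚ; this is why the degree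
-- bound p matters, and L meets it because its degree is 2h = p-1. For r > h the exact values of L
-- and S sit at different points, r-p and r, so the comparison leaves the unknown S(r-p). On a
-- residue class S is affine modulo p²: S(r+pt) ≡ (-1)ʳ + ptD. If p does not divide t, the number pD
-- can be read off from S(a). If p divides t, S(a) ≡ (-1)ʳ says nothing about D, and pD needs a
-- source of its own. That source is a polynomial congruent to S modulo p whose derivative is
-- explicit. Euler polynomials satisfy Eₙ(x) + Eₙ(x+1) = 2xⁿ; for n = p-1 the right side is 2 modulo
-- p at units, by Fermat, so 1 - Eₚ₋₁(-x) changes sign from one integer to the next as S does, and
-- Eₙ' = n·Eₙ₋₁ gives its derivative.

ring : AlmostCommutativeRing 0ℓ 0ℓ
ring = fromCommutativeRing ℚP.+-*-commutativeRing λ x → dec⇒maybe (0ℚ ℚP.≟ x)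

ℕ→ℚ≡mkℚ : ∀ n → ℕ→ℚ n ≡ mkℚ (ℤ.+ n) 0 (C.sym (C.1-coprimeTo n))
ℕ→ℚ≡mkℚ n = ℚP.↥p/↧p≡p (mkℚ (ℤ.+ n) 0 _)

ℕ→ℚ-+ : ∀ m n → ℕ→ℚ (m ℕ.+ n) ≡ ℕ→ℚ m + ℕ→ℚ n
ℕ→ℚ-+ m n = sym (trans (cong₂ _+_ (ℕ→ℚ≡mkℚ m) (ℕ→ℚ≡mkℚ n))
  (cong (_/ 1) (cong₂ ℤ._+_ (ℤP.*-identityʳ (ℤ.+ m)) (ℤP.*-identityʳ (ℤ.+ n)))))

ℕ→ℚ-* : ∀ m n → ℕ→ℚ (m ℕ.* n) ≡ ℕ→ℚ m * ℕ→ℚ n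
ℕ→ℚ-* m n = sym (trans (cong₂ _*_ (ℕ→ℚ≡mkℚ m) (ℕ→ℚ≡mkℚ n))
  (cong (_/ 1) (sym (ℤP.pos-* m n))))

ℕ→ℚ-suc : ∀ n → ℕ→ℚ (suc n) ≡ ℕ→ℚ n + 1ℚ
ℕ→ℚ-suc n = trans (cong ℕ→ℚ (ℕP.+-comm 1 n)) (ℕ→ℚ-+ n 1)

ℕ→ℚ-^ : ∀ m n → ℕ→ℚ m ^ n ≡ ℕ→ℚ (m ℕ.^ n)
ℕ→ℚ-^ m zero = refl
ℕ→ℚ-^ m (suc n) = trans (cong (ℕ→ℚ m *_) (ℕ→ℚ-^ m n)) (sym (ℕ→ℚ-* m (m ℕ.^ n)))

*-inv : ∀ x → x ≢ 0ℚ → x * inv x ≡ 1ℚ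
*-inv x@(mkℚ (ℤ.+ zero) _ _) x≢0 = contradiction (ℚP.↥p≡0⇒p≡0 x refl) x≢0
*-inv x@(mkℚ (ℤ.+ suc _) _ _) _ = ℚP.*-inverseʳ x
*-inv x@(mkℚ -[1+ _ ] _ _) _ = ℚP.*-inverseʳ x

ℕ→ℚ[1+n]≢0 : ∀ n → ℕ→ℚ (suc n) ≢ 0ℚ
ℕ→ℚ[1+n]≢0 n eq with () ← trans (sym (cong ↥_ (ℕ→ℚ≡mkℚ (suc n)))) (cong ↥_ eq)

ℕ→ℚ≢0 : ∀ n .{{_ : ℕ.NonZero n}} → ℕ→ℚ n ≢ 0ℚ
ℕ→ℚ≢0 (suc n) = ℕ→ℚ[1+n]≢0 n

*-inv-suc : ∀ n → ℕ→ℚ (suc n) * inv (ℕ→ℚ (suc n)) ≡ 1ℚ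
*-inv-suc n = *-inv (ℕ→ℚ (suc n)) (ℕ→ℚ[1+n]≢0 n)

-- `inv` is defined by cases and does not compute on open terms; its algebraic laws are derived from
-- this uniqueness.
inverse-unique : ∀ x y z → x * y ≡ 1ℚ → x * z ≡ 1ℚ → y ≡ z
inverse-unique x y z xy xz = begin
  y           ≡⟨ sym (ℚP.*-identityʳ y) ⟩
  y * 1ℚ      ≡⟨ cong (y *_) (sym xz) ⟩
  y * (x * z) ≡⟨ lemma x y z ⟩
  (x * y) * z ≡⟨ cong (_* z) xy ⟩
  1ℚ * z      ≡⟨ ℚP.*-identityˡ z ⟩
  z           ∎
  where
  lemma : ∀ x y z → y * (x * z) ≡ (x * y) * z
  lemma = solve-∀ ring

*-denominator : ∀ x → x * ℕ→ℚ (↧ₙ x) ≡ ↥ x / 1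
*-denominator x@(mkℚ i d-1 _) = trans (cong (x *_) (ℕ→ℚ≡mkℚ (suc d-1)))
  (ℚP.fromℚᵘ-cong {mkℚᵘ (i ℤ.* ℤ.+ suc d-1) (d-1 ℕ.* 1)} {mkℚᵘ i 0}
    (*≡* (trans (ℤP.*-identityʳ _) (cong (λ d → i ℤ.* ℤ.+ d) (sym (ℕP.*-identityʳ (suc d-1)))))))

↧ₙ-inv : ∀ x → x ≢ 0ℚ → ↧ₙ (inv x) ≡ ℤ.∣ ↥ x ∣
↧ₙ-inv x@(mkℚ (ℤ.+ zero) _ _) x≢0 = contradiction (ℚP.↥p≡0⇒p≡0 x refl) x≢0
↧ₙ-inv (mkℚ (ℤ.+ suc _) _ _) _ = refl
↧ₙ-inv (mkℚ -[1+ _ ] _ _) _ = refl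

^-+ : ∀ x m n → x ^ (m ℕ.+ n) ≡ x ^ m * x ^ n
^-+ x zero n = sym (ℚP.*-identityˡ (x ^ n))
^-+ x (suc m) n = trans (cong (x *_) (^-+ x m n)) (sym (ℚP.*-assoc x (x ^ m) (x ^ n)))

-- Finite sums

sumℚ-applyUpTo-suc : ∀ n f → sumℚ (applyUpTo f (suc n)) ≡ sumℚ (applyUpTo f n) + f n
sumℚ-applyUpTo-suc zero f = ℚP.+-comm (f 0) 0ℚ
sumℚ-applyUpTo-suc (suc n) f = trans
  (cong (f 0 +_) (sumℚ-applyUpTo-suc n (λ k → f (suc k))))
  (sym (ℚP.+-assoc (f 0) (sumℚ (applyUpTo (λ k → f (suc k)) n)) (f (suc n))))

sum0to≡ : ∀ n f → sum0to n f ≡ sumℚ (applyUpTo f (suc n))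
sum0to≡ n f = cong sumℚ (map-upTo f (suc n))

sum0to-zero : ∀ f → sum0to 0 f ≡ f 0
sum0to-zero f = ℚP.+-identityʳ (f 0)

sum0to-suc : ∀ n f → sum0to (suc n) f ≡ sum0to n f + f (suc n)
sum0to-suc n f = trans (sum0to≡ (suc n) f)
  (trans (sumℚ-applyUpTo-suc (suc n) f) (cong (_+ f (suc n)) (sym (sum0to≡ n f))))

sum0to-head : ∀ n f → sum0to (suc n) f ≡ f 0 + sum0to n (λ k → f (suc k))
sum0to-head n f = trans (sum0to≡ (suc n) f) (cong (f 0 +_) (sym (sum0to≡ n (λ k → f (suc k)))))

sum1to≡ : ∀ n f → f 0 + sum1to n f ≡ sum0to n f
sum1to≡ n f = trans (cong (λ s → f 0 + sumℚ s) (map-upTo (λ k → f (suc k)) n)) (sym (sum0to≡ n f))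

sum0to-cong : ∀ n {f g} → (∀ k → k ≤ n → f k ≡ g k) → sum0to n f ≡ sum0to n g
sum0to-cong zero {f} {g} eq = trans (sum0to-zero f) (trans (eq 0 z≤n) (sym (sum0to-zero g)))
sum0to-cong (suc n) {f} {g} eq = trans (sum0to-suc n f) (trans
  (cong₂ _+_ (sum0to-cong n λ k k≤n → eq k (ℕP.m≤n⇒m≤1+n k≤n)) (eq (suc n) ℕP.≤-refl))
  (sym (sum0to-suc n g)))

private
  interchange : ∀ a b c d → (a + b) + (c + d) ≡ (a + c) + (b + d)
  interchange = solve-∀ ring

sum0to-+ : ∀ n f g → sum0to n (λ k → f k + g k) ≡ sum0to n f + sum0to n g
sum0to-+ zero f g = trans (sum0to-zero (λ k → f k + g k))
  (sym (cong₂ _+_ (sum0to-zero f) (sum0to-zero g)))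
sum0to-+ (suc n) f g = begin
  sum0to (suc n) (λ k → f k + g k)
    ≡⟨ sum0to-suc n (λ k → f k + g k) ⟩
  sum0to n (λ k → f k + g k) + (f (suc n) + g (suc n))
    ≡⟨ cong (_+ (f (suc n) + g (suc n))) (sum0to-+ n f g) ⟩
  (sum0to n f + sum0to n g) + (f (suc n) + g (suc n))
    ≡⟨ interchange (sum0to n f) (sum0to n g) (f (suc n)) (g (suc n)) ⟩
  (sum0to n f + f (suc n)) + (sum0to n g + g (suc n))
    ≡⟨ sym (cong₂ _+_ (sum0to-suc n f) (sum0to-suc n g)) ⟩
  sum0to (suc n) f + sum0to (suc n) g ∎

-- Generalized binomial coefficients and the two sums of the theorem

2ℚ : ℚ
2ℚ = 1ℚ + 1ℚ

1/suc : ℕ → ℚ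
1/suc k = inv (ℕ→ℚ (suc k))

inv-! : ∀ k → inv (ℕ→ℚ (suc k !)) ≡ inv (ℕ→ℚ (k !)) * 1/suc k
inv-! k = inverse-unique (ℕ→ℚ (suc k !)) _ _ (*-inv _ (ℕ→ℚ≢0 (suc k !) {{(suc k) ℕP.!≢0}})) (begin
  ℕ→ℚ (suc k !) * (inv (ℕ→ℚ (k !)) * 1/suc k)
    ≡⟨ cong (_* (inv (ℕ→ℚ (k !)) * 1/suc k)) (ℕ→ℚ-* (suc k) (k !)) ⟩
  ℕ→ℚ (suc k) * ℕ→ℚ (k !) * (inv (ℕ→ℚ (k !)) * 1/suc k)
    ≡⟨ lemma (ℕ→ℚ (suc k)) (ℕ→ℚ (k !)) (inv (ℕ→ℚ (k !))) (1/suc k) ⟩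
  ℕ→ℚ (suc k) * 1/suc k * (ℕ→ℚ (k !) * inv (ℕ→ℚ (k !)))
    ≡⟨ cong₂ _*_ (*-inv-suc k) (*-inv _ (ℕ→ℚ≢0 (k !) {{k ℕP.!≢0}})) ⟩
  1ℚ * 1ℚ ≡⟨⟩
  1ℚ ∎)
  where
  lemma : ∀ a b c d → a * b * (c * d) ≡ a * d * (b * c)
  lemma = solve-∀ ring

binom-suc : ∀ x k → binom x (suc k) ≡ binom x k * (x - ℕ→ℚ k) * 1/suc k
binom-suc x k = trans (cong (prodℚ k _ * (x - ℕ→ℚ k) *_) (inv-! k))
  (lemma (prodℚ k (λ i → x - ℕ→ℚ i)) (x - ℕ→ℚ k) (inv (ℕ→ℚ (k !))) (1/suc k))
  where
  lemma : ∀ a b c d → a * b * (c * d) ≡ a * c * b * d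
  lemma = solve-∀ ring

-- The factors x+1, x, ..., x-k+1 are x+1 followed by those of `binom x k`. With `binom-suc`, this
-- makes every term at `suc k` a multiple of the term at `k`, so that telescoping steps become ring
-- identities.
binom-shift : ∀ x k → binom (x + 1ℚ) (suc k) ≡ binom x k * (x + 1ℚ) * 1/suc k
binom-shift x zero = trans (binom-suc (x + 1ℚ) 0) (lemma x (1/suc 0))
  where
  lemma : ∀ x v → 1ℚ * (x + 1ℚ - 0ℚ) * v ≡ 1ℚ * (x + 1ℚ) * v
  lemma = solve-∀ ring
binom-shift x (suc k) = begin
  binom (x + 1ℚ) (suc (suc k))
    ≡⟨ binom-suc (x + 1ℚ) (suc k) ⟩
  binom (x + 1ℚ) (suc k) * (x + 1ℚ - ℕ→ℚ (suc k)) * 1/suc (suc k)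
    ≡⟨ cong₂ (λ b n → b * (x + 1ℚ - n) * 1/suc (suc k)) (binom-shift x k) (ℕ→ℚ-suc k) ⟩
  binom x k * (x + 1ℚ) * 1/suc k * (x + 1ℚ - (ℕ→ℚ k + 1ℚ)) * 1/suc (suc k)
    ≡⟨ lemma x (ℕ→ℚ k) (binom x k) (1/suc k) (1/suc (suc k)) ⟩
  binom x k * (x - ℕ→ℚ k) * 1/suc k * (x + 1ℚ) * 1/suc (suc k)
    ≡⟨ cong (λ b → b * (x + 1ℚ) * 1/suc (suc k)) (sym (binom-suc x k)) ⟩
  binom x (suc k) * (x + 1ℚ) * 1/suc (suc k) ∎
  where
  lemma : ∀ x n b v w → b * (x + 1ℚ) * v * (x + 1ℚ - (n + 1ℚ)) * w ≡ b * (x - n) * v * (x + 1ℚ) * w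
  lemma = solve-∀ ring

binom-0 : ∀ k → binom 0ℚ (suc k) ≡ 0ℚ
binom-0 zero = refl
binom-0 (suc k) = trans (binom-suc 0ℚ (suc k))
  (trans (cong (λ b → b * (0ℚ - ℕ→ℚ (suc k)) * 1/suc (suc k)) (binom-0 k))
         (lemma (ℕ→ℚ (suc k)) (1/suc (suc k))))
  where
  lemma : ∀ n v → 0ℚ * (0ℚ - n) * v ≡ 0ℚ
  lemma = solve-∀ ring

binom-< : ∀ n k → n < k → binom (ℕ→ℚ n) k ≡ 0ℚ
binom-< zero (suc k) _ = binom-0 k
binom-< (suc n) (suc k) (s≤s n<k) = begin
  binom (ℕ→ℚ (suc n)) (suc k)        ≡⟨ cong (λ x → binom x (suc k)) (ℕ→ℚ-suc n) ⟩
  binom (ℕ→ℚ n + 1ℚ) (suc k)         ≡⟨ binom-shift (ℕ→ℚ n) k ⟩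
  binom (ℕ→ℚ n) k * (ℕ→ℚ n + 1ℚ) * 1/suc k ≡⟨ cong (λ b → b * (ℕ→ℚ n + 1ℚ) * 1/suc k) (binom-< n k n<k) ⟩
  0ℚ * (ℕ→ℚ n + 1ℚ) * 1/suc k            ≡⟨ lemma (ℕ→ℚ n) (1/suc k) ⟩
  0ℚ                                 ∎
  where
  lemma : ∀ n v → 0ℚ * (n + 1ℚ) * v ≡ 0ℚ
  lemma = solve-∀ ring

-- Telescoping identities and special values of the two sums

legendreSum : ℕ → ℚ → ℚ
legendreSum h a = sum0to h (λ k → binom a k * binom (- 1ℚ - a) k)

geometricSum : ℕ → ℚ → ℚ
geometricSum n a = sum0to n (λ k → binom a k * ((- ℕ→ℚ 2) ^ k))

legendreSum-reflect : ∀ h a → legendreSum h (- 1ℚ - a) ≡ legendreSum h a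
legendreSum-reflect h a = sum0to-cong h λ k _ →
  trans (ℚP.*-comm (binom (- 1ℚ - a) k) (binom (- 1ℚ - (- 1ℚ - a)) k))
        (cong (λ x → binom x k * binom (- 1ℚ - a) k) (lemma a))
  where
  lemma : ∀ a → - 1ℚ - (- 1ℚ - a) ≡ a
  lemma = solve-∀ ring

telescope : ∀ (f g : ℕ → ℚ) → f 0 ≡ g 0 → (∀ k → g k + f (suc k) ≡ g (suc k)) →
            ∀ n → sum0to n f ≡ g n
telescope f g base step zero = trans (sum0to-zero f) base
telescope f g base step (suc n) =
  trans (sum0to-suc n f) (trans (cong (_+ f (suc n)) (telescope f g base step n)) (step n))

-- With y = -2-a, the arguments -1-a and -1-(a+1) are y+1 and y. After the common factors are
-- removed, the telescoping step is (k+1)² - (a+1)² = (a-k)(-2-a-k).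
legendreSum-shift : ∀ h a → legendreSum h a + legendreSum h (a + 1ℚ) ≡
                            2ℚ * (binom a h * binom (- 1ℚ - (a + 1ℚ)) h)
legendreSum-shift h a = trans
  (sym (sum0to-+ h (λ k → binom a k * binom (- 1ℚ - a) k) (λ k → binom (a + 1ℚ) k * binom y k)))
  (telescope
  (λ k → binom a k * binom (- 1ℚ - a) k + binom (a + 1ℚ) k * binom y k)
  (λ k → 2ℚ * (binom a k * binom (- 1ℚ - (a + 1ℚ)) k)) refl step h)
  where
  y : ℚ
  y = - 1ℚ - (a + 1ℚ)
  y+1 : ∀ a → - 1ℚ - a ≡ - 1ℚ - (a + 1ℚ) + 1ℚ
  y+1 = solve-∀ ring
  lemma : ∀ a n b c v →
    2ℚ * (b * c) * ((n + 1ℚ) * v * ((n + 1ℚ) * v)) +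
      (b * (a - n) * v * (c * (- 1ℚ - (a + 1ℚ) + 1ℚ) * v) +
       b * (a + 1ℚ) * v * (c * (- 1ℚ - (a + 1ℚ) - n) * v)) ≡
    2ℚ * (b * (a - n) * v * (c * (- 1ℚ - (a + 1ℚ) - n) * v))
  lemma = solve-∀ ring
  one : ∀ k → (ℕ→ℚ k + 1ℚ) * 1/suc k ≡ 1ℚ
  one k = trans (cong (_* 1/suc k) (sym (ℕ→ℚ-suc k))) (*-inv-suc k)
  step : ∀ k → 2ℚ * (binom a k * binom y k) +
      (binom a (suc k) * binom (- 1ℚ - a) (suc k) + binom (a + 1ℚ) (suc k) * binom y (suc k)) ≡
      2ℚ * (binom a (suc k) * binom y (suc k))
  step k = begin
    2ℚ * (b * c) + (binom a (suc k) * binom (- 1ℚ - a) (suc k) + binom (a + 1ℚ) (suc k) * binom y (suc k))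
      -- The ring solver treats `1/suc k` as a free variable v; multiplying the first summand by
      -- ((k+1)v)² = 1 puts the relation (k+1)v = 1 into the identity.
      ≡⟨ cong₂ _+_
           (sym (trans (cong (2ℚ * (b * c) *_) (cong₂ _*_ (one k) (one k))) (ℚP.*-identityʳ (2ℚ * (b * c)))))
           (cong₂ _+_
             (cong₂ _*_ (binom-suc a k) (trans (cong (λ x → binom x (suc k)) (y+1 a)) (binom-shift y k)))
             (cong₂ _*_ (binom-shift a k) (binom-suc y k))) ⟩
    _ ≡⟨ lemma a (ℕ→ℚ k) b c (1/suc k) ⟩
    _ ≡⟨ cong (2ℚ *_) (sym (cong₂ _*_ (binom-suc a k) (binom-suc y k))) ⟩
    2ℚ * (binom a (suc k) * binom y (suc k)) ∎
    where
    b = binom a k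
    c = binom y k

-- For a base c the step needs 2(k+1) + c(2a-k+1) to be divisible by a-k; at a = k this is
-- (2+c)(k+1), which singles out c = -2. The sum is a truncation of (1-2)ᵃ, whence the values (-1)ⁿ.
geometricSum-shift : ∀ n a → geometricSum n a + geometricSum n (a + 1ℚ) ≡
                             2ℚ * (binom a n * ((- ℕ→ℚ 2) ^ n))
geometricSum-shift n a = trans
  (sym (sum0to-+ n (λ k → binom a k * ((- ℕ→ℚ 2) ^ k)) (λ k → binom (a + 1ℚ) k * ((- ℕ→ℚ 2) ^ k))))
  (telescope
  (λ k → binom a k * ((- ℕ→ℚ 2) ^ k) + binom (a + 1ℚ) k * ((- ℕ→ℚ 2) ^ k))
  (λ k → 2ℚ * (binom a k * ((- ℕ→ℚ 2) ^ k))) refl step n)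
  where
  lemma : ∀ a n b v e →
    2ℚ * (b * e) * ((n + 1ℚ) * v) + (b * (a - n) * v * (- 2ℚ * e) + b * (a + 1ℚ) * v * (- 2ℚ * e)) ≡
    2ℚ * (b * (a - n) * v * (- 2ℚ * e))
  lemma = solve-∀ ring
  step : ∀ k → 2ℚ * (binom a k * ((- ℕ→ℚ 2) ^ k)) +
      (binom a (suc k) * ((- ℕ→ℚ 2) ^ suc k) + binom (a + 1ℚ) (suc k) * ((- ℕ→ℚ 2) ^ suc k)) ≡
      2ℚ * (binom a (suc k) * ((- ℕ→ℚ 2) ^ suc k))
  step k = begin
    2ℚ * (b * e) + (binom a (suc k) * (- 2ℚ * e) + binom (a + 1ℚ) (suc k) * (- 2ℚ * e))
      ≡⟨ cong₂ _+_
           (sym (trans (cong (2ℚ * (b * e) *_)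
             (trans (cong (_* 1/suc k) (sym (ℕ→ℚ-suc k))) (*-inv-suc k))) (ℚP.*-identityʳ (2ℚ * (b * e)))))
           (cong₂ _+_ (cong (_* (- 2ℚ * e)) (binom-suc a k)) (cong (_* (- 2ℚ * e)) (binom-shift a k))) ⟩
    _ ≡⟨ lemma a (ℕ→ℚ k) b (1/suc k) e ⟩
    _ ≡⟨ cong (λ x → 2ℚ * (x * (- 2ℚ * e))) (sym (binom-suc a k)) ⟩
    2ℚ * (binom a (suc k) * (- 2ℚ * e)) ∎
    where
    b = binom a k
    e = (- ℕ→ℚ 2) ^ k

alternating : ∀ (f : ℚ → ℚ) N → f 0ℚ ≡ 1ℚ → (∀ n → n < N → f (ℕ→ℚ n) + f (ℕ→ℚ n + 1ℚ) ≡ 0ℚ) →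
              ∀ n → n ≤ N → f (ℕ→ℚ n) ≡ (- 1ℚ) ^ n
alternating f N base step zero _ = base
alternating f N base step (suc n) n<N = begin
  f (ℕ→ℚ (suc n))                               ≡⟨ cong f (ℕ→ℚ-suc n) ⟩
  f (ℕ→ℚ n + 1ℚ)                                ≡⟨ lemma (f (ℕ→ℚ n)) (f (ℕ→ℚ n + 1ℚ)) ⟩
  (f (ℕ→ℚ n) + f (ℕ→ℚ n + 1ℚ)) + - 1ℚ * f (ℕ→ℚ n) ≡⟨ cong₂ (λ s v → s + - 1ℚ * v) (step n n<N)
                                                       (alternating f N base step n (ℕP.<⇒≤ n<N)) ⟩
  0ℚ + - 1ℚ * ((- 1ℚ) ^ n)                      ≡⟨ ℚP.+-identityˡ _ ⟩
  - 1ℚ * ((- 1ℚ) ^ n)                           ∎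
  where
  lemma : ∀ v w → w ≡ (v + w) + - 1ℚ * v
  lemma = solve-∀ ring

binom-sum-0 : ∀ n (c : ℕ → ℚ) → c 0 ≡ 1ℚ → sum0to n (λ k → binom 0ℚ k * c k) ≡ 1ℚ
binom-sum-0 n c c0 = telescope (λ k → binom 0ℚ k * c k) (λ _ → 1ℚ) (trans (cong (1ℚ *_) c0) refl)
  (λ k → trans (cong (λ b → 1ℚ + b * c (suc k)) (binom-0 k)) (lemma (c (suc k)))) n
  where
  lemma : ∀ c → 1ℚ + 0ℚ * c ≡ 1ℚ
  lemma = solve-∀ ring

private
  2*0* : ∀ c → 2ℚ * (0ℚ * c) ≡ 0ℚ
  2*0* = solve-∀ ring

legendreSum-value : ∀ h n → n ≤ h → legendreSum h (ℕ→ℚ n) ≡ (- 1ℚ) ^ n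
legendreSum-value h = alternating (legendreSum h) h (binom-sum-0 h (λ k → binom (- 1ℚ - 0ℚ) k) refl)
  λ n n<h → trans (legendreSum-shift h (ℕ→ℚ n))
    (trans (cong (λ b → 2ℚ * (b * binom (- 1ℚ - (ℕ→ℚ n + 1ℚ)) h)) (binom-< n h n<h))
           (2*0* (binom (- 1ℚ - (ℕ→ℚ n + 1ℚ)) h)))

geometricSum-value : ∀ N n → n ≤ N → geometricSum N (ℕ→ℚ n) ≡ (- 1ℚ) ^ n
geometricSum-value N = alternating (geometricSum N) N (binom-sum-0 N ((- ℕ→ℚ 2) ^_) refl)
  λ n n<N → trans (geometricSum-shift N (ℕ→ℚ n))
    (trans (cong (λ b → 2ℚ * (b * ((- ℕ→ℚ 2) ^ N))) (binom-< n N n<N)) (2*0* ((- ℕ→ℚ 2) ^ N)))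

binom-ℕ : ∀ n k → binom (ℕ→ℚ n) k ≡ ℕ→ℚ (n C k)
binom-ℕ zero zero = refl
binom-ℕ (suc n) zero = refl
binom-ℕ zero (suc k) = trans (binom-0 k) (cong ℕ→ℚ (sym (k>n⇒nCk≡0 {0} {suc k} (s≤s z≤n))))
binom-ℕ (suc n) (suc k) = begin
  binom (ℕ→ℚ (suc n)) (suc k)               ≡⟨ cong (λ x → binom x (suc k)) (ℕ→ℚ-suc n) ⟩
  binom (x + 1ℚ) (suc k)                    ≡⟨ binom-shift x k ⟩
  b * (x + 1ℚ) * 1/suc k                    ≡⟨ lemma x (ℕ→ℚ k) b (1/suc k) ⟩
  b * ((ℕ→ℚ k + 1ℚ) * 1/suc k) + b * (x - ℕ→ℚ k) * 1/suc k
    ≡⟨ cong₂ _+_ (trans (cong (b *_) (trans (cong (_* 1/suc k) (sym (ℕ→ℚ-suc k))) (*-inv-suc k)))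
                        (ℚP.*-identityʳ b)) (sym (binom-suc x k)) ⟩
  b + binom x (suc k)                       ≡⟨ cong₂ _+_ (binom-ℕ n k) (binom-ℕ n (suc k)) ⟩
  ℕ→ℚ (n C k) + ℕ→ℚ (n C suc k)             ≡⟨ sym (ℕ→ℚ-+ (n C k) (n C suc k)) ⟩
  ℕ→ℚ (n C k ℕ.+ n C suc k)                 ≡⟨ cong ℕ→ℚ (nCk+nC[k+1]≡[n+1]C[k+1] n k) ⟩
  ℕ→ℚ (suc n C suc k)                       ∎
  where
  x = ℕ→ℚ n
  b = binom x k
  lemma : ∀ x n b v → b * (x + 1ℚ) * v ≡ b * ((n + 1ℚ) * v) + b * (x - n) * v
  lemma = solve-∀ ring

C-absorption : ∀ n k → ℕ→ℚ (suc n C suc k) ≡ ℕ→ℚ (n C k) * ℕ→ℚ (suc n) * 1/suc k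
C-absorption n k = begin
  ℕ→ℚ (suc n C suc k)                  ≡⟨ sym (binom-ℕ (suc n) (suc k)) ⟩
  binom (ℕ→ℚ (suc n)) (suc k)          ≡⟨ cong (λ x → binom x (suc k)) (ℕ→ℚ-suc n) ⟩
  binom (ℕ→ℚ n + 1ℚ) (suc k)           ≡⟨ binom-shift (ℕ→ℚ n) k ⟩
  binom (ℕ→ℚ n) k * (ℕ→ℚ n + 1ℚ) * 1/suc k
    ≡⟨ cong₂ (λ b x → b * x * 1/suc k) (binom-ℕ n k) (sym (ℕ→ℚ-suc n)) ⟩
  ℕ→ℚ (n C k) * ℕ→ℚ (suc n) * 1/suc k  ∎

-- Binomial convolution and Euler polynomials

∂ : (ℕ → ℚ) → ℕ → ℚ
∂ a n = a (suc n)

-- Binomial convolution Σ C(n,r) aᵣ bₙ₋ᵣ, i.e. the product of exponential generating functions;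
-- the recursion is the Leibniz rule.
conv : (ℕ → ℚ) → (ℕ → ℚ) → ℕ → ℚ
conv a b zero = a 0 * b 0
conv a b (suc n) = conv (∂ a) b n + conv a (∂ b) n

conv-cong : ∀ {a a′ b b′} → (∀ n → a n ≡ a′ n) → (∀ n → b n ≡ b′ n) → ∀ n → conv a b n ≡ conv a′ b′ n
conv-cong a≗ b≗ zero = cong₂ _*_ (a≗ 0) (b≗ 0)
conv-cong a≗ b≗ (suc n) = cong₂ _+_ (conv-cong (λ k → a≗ (suc k)) b≗ n) (conv-cong a≗ (λ k → b≗ (suc k)) n)

conv-comm : ∀ a b n → conv a b n ≡ conv b a n
conv-comm a b zero = ℚP.*-comm (a 0) (b 0)
conv-comm a b (suc n) = trans (cong₂ _+_ (conv-comm (∂ a) b n) (conv-comm a (∂ b) n))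
  (ℚP.+-comm (conv b (∂ a) n) (conv (∂ b) a n))

conv-distribˡ-+ : ∀ a b c n → conv a (λ k → b k + c k) n ≡ conv a b n + conv a c n
conv-distribˡ-+ a b c zero = ℚP.*-distribˡ-+ (a 0) (b 0) (c 0)
conv-distribˡ-+ a b c (suc n) = trans
  (cong₂ _+_ (conv-distribˡ-+ (∂ a) b c n) (conv-distribˡ-+ a (∂ b) (∂ c) n))
  (interchange (conv (∂ a) b n) (conv (∂ a) c n) (conv a (∂ b) n) (conv a (∂ c) n))

conv-distribʳ-+ : ∀ a b c n → conv (λ k → a k + b k) c n ≡ conv a c n + conv b c n
conv-distribʳ-+ a b c n = trans (conv-comm (λ k → a k + b k) c n)
  (trans (conv-distribˡ-+ c a b n) (cong₂ _+_ (conv-comm c a n) (conv-comm c b n)))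

conv-scaleʳ : ∀ x a b n → conv a (λ k → x * b k) n ≡ x * conv a b n
conv-scaleʳ x a b zero = lemma x (a 0) (b 0)
  where
  lemma : ∀ x y z → y * (x * z) ≡ x * (y * z)
  lemma = solve-∀ ring
conv-scaleʳ x a b (suc n) = trans
  (cong₂ _+_ (conv-scaleʳ x (∂ a) b n) (conv-scaleʳ x a (∂ b) n))
  (sym (ℚP.*-distribˡ-+ x (conv (∂ a) b n) (conv a (∂ b) n)))

conv-scaleˡ : ∀ x a b n → conv (λ k → x * a k) b n ≡ x * conv a b n
conv-scaleˡ x a b n = trans (conv-comm (λ k → x * a k) b n)
  (trans (conv-scaleʳ x b a n) (cong (x *_) (conv-comm b a n)))

-- Both sides obey the Leibniz rule for three factors, so induction replaces any rearrangement of
-- double sums.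
conv-assoc : ∀ a b c n → conv (conv a b) c n ≡ conv a (conv b c) n
conv-assoc a b c zero = ℚP.*-assoc (a 0) (b 0) (c 0)
conv-assoc a b c (suc n) = begin
  conv (λ k → conv (∂ a) b k + conv a (∂ b) k) c n + conv (conv a b) (∂ c) n
    ≡⟨ cong₂ _+_ (conv-distribʳ-+ (conv (∂ a) b) (conv a (∂ b)) c n) (conv-assoc a b (∂ c) n) ⟩
  (conv (conv (∂ a) b) c n + conv (conv a (∂ b)) c n) + conv a (conv b (∂ c)) n
    ≡⟨ cong (_+ conv a (conv b (∂ c)) n) (cong₂ _+_ (conv-assoc (∂ a) b c n) (conv-assoc a (∂ b) c n)) ⟩
  (conv (∂ a) (conv b c) n + conv a (conv (∂ b) c) n) + conv a (conv b (∂ c)) n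
    ≡⟨ ℚP.+-assoc (conv (∂ a) (conv b c) n) (conv a (conv (∂ b) c) n) (conv a (conv b (∂ c)) n) ⟩
  conv (∂ a) (conv b c) n + (conv a (conv (∂ b) c) n + conv a (conv b (∂ c)) n)
    ≡⟨ cong (conv (∂ a) (conv b c) n +_) (sym (conv-distribˡ-+ a (conv (∂ b) c) (conv b (∂ c)) n)) ⟩
  conv (∂ a) (conv b c) n + conv a (λ k → conv (∂ b) c k + conv b (∂ c) k) n ∎

-- The binomial theorem, in the form exp(xu)·exp(yu) = exp((x+y)u).
conv-^ : ∀ x y n → conv (x ^_) (y ^_) n ≡ (x + y) ^ n
conv-^ x y zero = refl
conv-^ x y (suc n) = begin
  conv (λ k → x * x ^ k) (y ^_) n + conv (x ^_) (λ k → y * y ^ k) n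
    ≡⟨ cong₂ _+_ (conv-scaleˡ x (x ^_) (y ^_) n) (conv-scaleʳ y (x ^_) (y ^_) n) ⟩
  x * conv (x ^_) (y ^_) n + y * conv (x ^_) (y ^_) n
    ≡⟨ sym (ℚP.*-distribʳ-+ (conv (x ^_) (y ^_) n) x y) ⟩
  (x + y) * conv (x ^_) (y ^_) n
    ≡⟨ cong ((x + y) *_) (conv-^ x y n) ⟩
  (x + y) * (x + y) ^ n ∎

δ : ℕ → ℚ
δ zero = 1ℚ
δ (suc _) = 0ℚ

conv-0 : ∀ a n → conv (λ _ → 0ℚ) a n ≡ 0ℚ
conv-0 a zero = ℚP.*-zeroˡ (a 0)
conv-0 a (suc n) = cong₂ _+_ (conv-0 a n) (conv-0 (∂ a) n)

conv-δ : ∀ a n → conv δ a n ≡ a n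
conv-δ a zero = ℚP.*-identityˡ (a 0)
conv-δ a (suc n) = trans (cong₂ _+_ (conv-0 a n) (conv-δ (∂ a) n)) (ℚP.+-identityˡ (a (suc n)))

-- Pascal's rule matches the Leibniz rule. The order of the factors is that of `eulerPoly`, so the
-- lemma applies there without rewriting.
conv≡sum : ∀ a b n → sum0to n (λ r → ℕ→ℚ (n C r) * b (n ∸ r) * a r) ≡ conv a b n
conv≡sum a b zero = trans (sum0to-zero (λ r → ℕ→ℚ (0 C r) * b (0 ∸ r) * a r)) (lemma (b 0) (a 0))
  where
  lemma : ∀ y x → 1ℚ * y * x ≡ x * y
  lemma = solve-∀ ring
conv≡sum a b (suc n) = begin
  sum0to (suc n) (λ r → ℕ→ℚ (suc n C r) * b (suc n ∸ r) * a r)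
    ≡⟨ sum0to-head n (λ r → ℕ→ℚ (suc n C r) * b (suc n ∸ r) * a r) ⟩
  first + sum0to n (λ r → ℕ→ℚ (suc n C suc r) * b (n ∸ r) * a (suc r))
    ≡⟨ cong (first +_) (trans (sum0to-cong n λ r _ → pascal r) (sum0to-+ n left right)) ⟩
  first + (sum0to n left + sum0to n right)
    ≡⟨ lemma first (sum0to n left) (sum0to n right) ⟩
  sum0to n left + (first + sum0to n right)
    ≡⟨ cong₂ _+_ (conv≡sum (∂ a) b n) (trans (sym (sum0to-head n row)) (trans (sum0to-suc n row) last)) ⟩
  conv (∂ a) b n + sum0to n row
    ≡⟨ cong (conv (∂ a) b n +_) (trans (sum0to-cong n reindex) (conv≡sum a (∂ b) n)) ⟩
  conv (∂ a) b n + conv a (∂ b) n ∎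
  where
  first = 1ℚ * b (suc n) * a 0
  left right row : ℕ → ℚ
  left r = ℕ→ℚ (n C r) * b (n ∸ r) * a (suc r)
  right r = ℕ→ℚ (n C suc r) * b (n ∸ r) * a (suc r)
  row r = ℕ→ℚ (n C r) * b (suc n ∸ r) * a r
  distrib : ∀ c d x y → (c + d) * x * y ≡ c * x * y + d * x * y
  distrib = solve-∀ ring
  lemma : ∀ f x y → f + (x + y) ≡ x + (f + y)
  lemma = solve-∀ ring
  pascal : ∀ r → ℕ→ℚ (suc n C suc r) * b (n ∸ r) * a (suc r) ≡ left r + right r
  pascal r = trans
    (cong (λ c → c * b (n ∸ r) * a (suc r))
      (trans (cong ℕ→ℚ (sym (nCk+nC[k+1]≡[n+1]C[k+1] n r))) (ℕ→ℚ-+ (n C r) (n C suc r))))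
    (distrib (ℕ→ℚ (n C r)) (ℕ→ℚ (n C suc r)) (b (n ∸ r)) (a (suc r)))
  zeros : ∀ s x y → s + 0ℚ * x * y ≡ s
  zeros = solve-∀ ring
  -- Row n is extended by its zero entry C(n,n+1), so that `first` and the sum of `right` together
  -- form one full row.
  last : sum0to n row + row (suc n) ≡ sum0to n row
  last = trans (cong (λ c → sum0to n row + ℕ→ℚ c * b (suc n ∸ suc n) * a (suc n)) (k>n⇒nCk≡0 (ℕP.n<1+n n)))
    (zeros (sum0to n row) (b (suc n ∸ suc n)) (a (suc n)))
  reindex : ∀ r → r ≤ n → row r ≡ ℕ→ℚ (n C r) * ∂ b (n ∸ r) * a r
  reindex r r≤n = cong (λ k → ℕ→ℚ (n C r) * b k * a r) (ℕP.+-∸-assoc 1 r≤n)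

-- Euler numbers and Euler polynomials through generating functions

even : ℕ → ℚ
even zero = 1ℚ
even (suc zero) = 0ℚ
even (suc (suc n)) = even n

-- `even` lists the coefficients of cosh, and this is exp(-u) + exp(u) = 2·cosh u.
even-^ : ∀ n → (- 1ℚ) ^ n + 1ℚ ^ n ≡ 2ℚ * even n
even-^ zero = refl
even-^ (suc zero) = refl
even-^ (suc (suc n)) = trans (lemma ((- 1ℚ) ^ n) (1ℚ ^ n)) (even-^ n)
  where
  lemma : ∀ x y → - 1ℚ * (- 1ℚ * x) + 1ℚ * (1ℚ * y) ≡ x + y
  lemma = solve-∀ ring

sum-even : ∀ n (f : ℕ → ℚ) → sum0to n (λ r → f r * even r) ≡ sum0to (n ℕ./ 2) (λ k → f (2 ℕ.* k))
sum-even zero f = trans (sum0to-zero (λ r → f r * even r))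
  (trans (ℚP.*-identityʳ (f 0)) (sym (sum0to-zero (λ k → f (2 ℕ.* k)))))
sum-even (suc zero) f = begin
  sum0to 1 (λ r → f r * even r)     ≡⟨ sum0to-suc 0 (λ r → f r * even r) ⟩
  sum0to 0 (λ r → f r * even r) + f 1 * 0ℚ ≡⟨ cong (_+ f 1 * 0ℚ) (sum0to-zero (λ r → f r * even r)) ⟩
  f 0 * 1ℚ + f 1 * 0ℚ               ≡⟨ lemma (f 0) (f 1) ⟩
  f 0                               ≡⟨ sym (sum0to-zero (λ k → f (2 ℕ.* k))) ⟩
  sum0to 0 (λ k → f (2 ℕ.* k))      ∎
  where
  lemma : ∀ x y → x * 1ℚ + y * 0ℚ ≡ x
  lemma = solve-∀ ring
sum-even (suc (suc n)) f = begin
  sum0to (suc (suc n)) (λ r → f r * even r)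
    ≡⟨ trans (sum0to-head (suc n) (λ r → f r * even r))
         (cong (f 0 * 1ℚ +_) (sum0to-head n (λ r → f (suc r) * even (suc r)))) ⟩
  f 0 * 1ℚ + (f 1 * 0ℚ + sum0to n (λ r → f (suc (suc r)) * even r))
    ≡⟨ lemma (f 0) (f 1) _ ⟩
  f 0 + sum0to n (λ r → f (suc (suc r)) * even r)
    ≡⟨ cong (f 0 +_) (sum-even n (λ r → f (suc (suc r)))) ⟩
  f 0 + sum0to (n ℕ./ 2) (λ k → f (suc (suc (2 ℕ.* k))))
    ≡⟨ cong (f 0 +_) (sum0to-cong (n ℕ./ 2) λ k _ → cong f (sym (ℕP.*-suc 2 k))) ⟩
  f 0 + sum0to (n ℕ./ 2) (λ k → f (2 ℕ.* suc k))
    ≡⟨ sym (sum0to-head (n ℕ./ 2) (λ k → f (2 ℕ.* k))) ⟩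
  sum0to (suc (n ℕ./ 2)) (λ k → f (2 ℕ.* k))
    ≡⟨ cong (λ m → sum0to m (λ k → f (2 ℕ.* k))) (sym (+-distrib-/-∣ˡ {2} n {2} ∣-refl)) ⟩
  sum0to (suc (suc n) ℕ./ 2) (λ k → f (2 ℕ.* k)) ∎
  where
  lemma : ∀ x y s → x * 1ℚ + (y * 0ℚ + s) ≡ x + s
  lemma = solve-∀ ring

sum1to-cong : ∀ n f g → (∀ k → f (suc k) ≡ g (suc k)) → sum1to n f ≡ sum1to n g
sum1to-cong n f g eq = cong sumℚ (map-cong eq (upTo n))

E'-fuel : ∀ f g n → n < f → n < g → E' f n ≡ E' g n
E'-fuel (suc f) (suc g) zero _ _ = refl
E'-fuel (suc f) (suc g) (suc m) (s≤s m<f) (s≤s m<g) = cong -_ (sum1to-cong (suc m ℕ./ 2)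
  (λ k → ℕ→ℚ (suc m C (2 ℕ.* k)) * E' f (suc m ∸ 2 ℕ.* k))
  (λ k → ℕ→ℚ (suc m C (2 ℕ.* k)) * E' g (suc m ∸ 2 ℕ.* k))
  λ k → cong (ℕ→ℚ (suc m C (2 ℕ.* suc k)) *_)
    -- The index `suc m ∸ 2 * suc k` reduces to `m ∸ (k + 1 * suc k)`, hence is at most `m`.
    (E'-fuel f g (suc m ∸ 2 ℕ.* suc k)
      (ℕP.≤-<-trans (ℕP.m∸n≤m m (k ℕ.+ 1 ℕ.* suc k)) m<f)
      (ℕP.≤-<-trans (ℕP.m∸n≤m m (k ℕ.+ 1 ℕ.* suc k)) m<g)))

eulerNumber-suc : ∀ m →
  sum0to (suc m ℕ./ 2) (λ k → ℕ→ℚ (suc m C (2 ℕ.* k)) * eulerNumber (suc m ∸ 2 ℕ.* k)) ≡ 0ℚ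
eulerNumber-suc m = begin
  sum0to (suc m ℕ./ 2) f
    ≡⟨ sym (sum1to≡ (suc m ℕ./ 2) f) ⟩
  1ℚ * eulerNumber (suc m) + sum1to (suc m ℕ./ 2) f
    ≡⟨ cong (λ s → 1ℚ * - s + sum1to (suc m ℕ./ 2) f) (sum1to-cong (suc m ℕ./ 2)
         (λ k → ℕ→ℚ (suc m C (2 ℕ.* k)) * E' (suc m) (suc m ∸ 2 ℕ.* k)) f λ k →
         cong (ℕ→ℚ (suc m C (2 ℕ.* suc k)) *_)
           (E'-fuel (suc m) (suc (suc m ∸ 2 ℕ.* suc k)) (suc m ∸ 2 ℕ.* suc k)
             (s≤s (ℕP.m∸n≤m m (k ℕ.+ 1 ℕ.* suc k))) ℕP.≤-refl)) ⟩
  1ℚ * - sum1to (suc m ℕ./ 2) f + sum1to (suc m ℕ./ 2) f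
    ≡⟨ lemma (sum1to (suc m ℕ./ 2) f) ⟩
  0ℚ ∎
  where
  f : ℕ → ℚ
  f k = ℕ→ℚ (suc m C (2 ℕ.* k)) * eulerNumber (suc m ∸ 2 ℕ.* k)
  lemma : ∀ s → 1ℚ * - s + s ≡ 0ℚ
  lemma = solve-∀ ring

-- The generating function of the Euler numbers is 1/cosh.
conv-euler-even : ∀ n → conv eulerNumber even n ≡ δ n
conv-euler-even zero = refl
conv-euler-even (suc m) = begin
  conv eulerNumber even (suc m)
    ≡⟨ conv-comm eulerNumber even (suc m) ⟩
  conv even eulerNumber (suc m)
    ≡⟨ sym (conv≡sum even eulerNumber (suc m)) ⟩
  sum0to (suc m) (λ r → ℕ→ℚ (suc m C r) * eulerNumber (suc m ∸ r) * even r)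
    ≡⟨ sum-even (suc m) (λ r → ℕ→ℚ (suc m C r) * eulerNumber (suc m ∸ r)) ⟩
  sum0to (suc m ℕ./ 2) (λ k → ℕ→ℚ (suc m C (2 ℕ.* k)) * eulerNumber (suc m ∸ 2 ℕ.* k))
    ≡⟨ eulerNumber-suc m ⟩
  0ℚ ∎

2^-inv : ∀ n → ℕ→ℚ 2 ^ n * inv (ℕ→ℚ 2 ^ n) ≡ 1ℚ
2^-inv n = *-inv (ℕ→ℚ 2 ^ n) λ eq →
  ℕ→ℚ≢0 (2 ℕ.^ n) {{ℕP.m^n≢0 2 n}} (trans (sym (ℕ→ℚ-^ 2 n)) eq)

eulerPoly≡conv : ∀ n x → eulerPoly n x ≡
  inv (ℕ→ℚ 2 ^ n) * conv eulerNumber ((ℕ→ℚ 2 * x - 1ℚ) ^_) n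
eulerPoly≡conv n x = cong (inv (ℕ→ℚ 2 ^ n) *_) (conv≡sum eulerNumber ((ℕ→ℚ 2 * x - 1ℚ) ^_) n)

*-^ : ∀ x y n → (x * y) ^ n ≡ x ^ n * y ^ n
*-^ x y zero = refl
*-^ x y (suc n) = trans (cong (x * y *_) (*-^ x y n)) (lemma x y (x ^ n) (y ^ n))
  where
  lemma : ∀ x y a b → x * y * (a * b) ≡ x * a * (y * b)
  lemma = solve-∀ ring

-- The points 2x-1 and 2(x+1)-1 are -1+y and 1+y with y = 2x. So, up to the power of 2, the
-- generating function of the left side is (exp(-u) + exp(u))·exp(yu)/cosh u = 2·exp(yu).
eulerPoly-shift : ∀ n x → eulerPoly n x + eulerPoly n (x + 1ℚ) ≡ 2ℚ * x ^ n
eulerPoly-shift n x = begin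
  eulerPoly n x + eulerPoly n (x + 1ℚ)
    ≡⟨ cong₂ _+_ (eulerPoly≡conv n x) (eulerPoly≡conv n (x + 1ℚ)) ⟩
  i * conv E ((ℕ→ℚ 2 * x - 1ℚ) ^_) n + i * conv E ((ℕ→ℚ 2 * (x + 1ℚ) - 1ℚ) ^_) n
    ≡⟨ cong₂ (λ y z → i * y + i * z) (split (- 1ℚ) (minus x)) (split 1ℚ (plus x)) ⟩
  i * conv E (conv ((- 1ℚ) ^_) (y ^_)) n + i * conv E (conv (1ℚ ^_) (y ^_)) n
    ≡⟨ sym (ℚP.*-distribˡ-+ i (conv E (conv ((- 1ℚ) ^_) (y ^_)) n) (conv E (conv (1ℚ ^_) (y ^_)) n)) ⟩
  i * (conv E (conv ((- 1ℚ) ^_) (y ^_)) n + conv E (conv (1ℚ ^_) (y ^_)) n)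
    ≡⟨ cong (i *_) (sym (conv-distribˡ-+ E (conv ((- 1ℚ) ^_) (y ^_)) (conv (1ℚ ^_) (y ^_)) n)) ⟩
  i * conv E (λ k → conv ((- 1ℚ) ^_) (y ^_) k + conv (1ℚ ^_) (y ^_) k) n
    ≡⟨ cong (i *_) (conv-cong {a = E} (λ _ → refl) (λ k →
         trans (sym (conv-distribʳ-+ ((- 1ℚ) ^_) (1ℚ ^_) (y ^_) k))
         (trans (conv-cong {b = y ^_} even-^ (λ _ → refl) k) (conv-scaleˡ 2ℚ even (y ^_) k))) n) ⟩
  i * conv E (λ k → 2ℚ * conv even (y ^_) k) n
    ≡⟨ cong (i *_) (conv-scaleʳ 2ℚ E (conv even (y ^_)) n) ⟩
  i * (2ℚ * conv E (conv even (y ^_)) n)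
    ≡⟨ cong (λ z → i * (2ℚ * z)) (trans (sym (conv-assoc E even (y ^_) n))
         (trans (conv-cong {b = y ^_} conv-euler-even (λ _ → refl) n) (conv-δ (y ^_) n))) ⟩
  i * (2ℚ * y ^ n)
    ≡⟨ cong (λ z → i * (2ℚ * z)) (*-^ (ℕ→ℚ 2) x n) ⟩
  i * (2ℚ * (ℕ→ℚ 2 ^ n * x ^ n))
    ≡⟨ regroup i (ℕ→ℚ 2 ^ n) (x ^ n) ⟩
  ℕ→ℚ 2 ^ n * i * (2ℚ * x ^ n)
    ≡⟨ trans (cong (_* (2ℚ * x ^ n)) (2^-inv n)) (ℚP.*-identityˡ (2ℚ * x ^ n)) ⟩
  2ℚ * x ^ n ∎
  where
  E = eulerNumber
  i = inv (ℕ→ℚ 2 ^ n)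
  y = ℕ→ℚ 2 * x
  minus : ∀ x → 2ℚ * x - 1ℚ ≡ - 1ℚ + 2ℚ * x
  minus = solve-∀ ring
  plus : ∀ x → 2ℚ * (x + 1ℚ) - 1ℚ ≡ 1ℚ + 2ℚ * x
  plus = solve-∀ ring
  split : ∀ {z} w → z ≡ w + y → conv E (z ^_) n ≡ conv E (conv (w ^_) (y ^_)) n
  split w refl = conv-cong {a = E} (λ _ → refl) (λ k → sym (conv-^ w y k)) n
  regroup : ∀ i t w → i * (2ℚ * (t * w)) ≡ t * i * (2ℚ * w)
  regroup = solve-∀ ring

inv-2^-suc : ∀ m → inv (ℕ→ℚ 2 ^ suc m) * 2ℚ ≡ inv (ℕ→ℚ 2 ^ m)
inv-2^-suc m = inverse-unique (ℕ→ℚ 2 ^ m) _ _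
  (trans (lemma (ℕ→ℚ 2 ^ m) (inv (ℕ→ℚ 2 ^ suc m))) (2^-inv (suc m))) (2^-inv m)
  where
  lemma : ∀ x i → x * (i * 2ℚ) ≡ 2ℚ * x * i
  lemma = solve-∀ ring

sign-even : ∀ h → (- 1ℚ) ^ (h ℕ.+ h) ≡ 1ℚ
sign-even zero = refl
sign-even (suc h) = trans (cong (λ n → (- 1ℚ) ^ suc n) (ℕP.+-suc h h))
  (trans (lemma ((- 1ℚ) ^ (h ℕ.+ h))) (sign-even h))
  where
  lemma : ∀ x → - 1ℚ * (- 1ℚ * x) ≡ x
  lemma = solve-∀ ring

neg-^-even : ∀ h x → (- x) ^ (h ℕ.+ h) ≡ x ^ (h ℕ.+ h)
neg-^-even h x = begin
  (- x) ^ (h ℕ.+ h)                       ≡⟨ cong (_^ (h ℕ.+ h)) (lemma x) ⟩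
  (- 1ℚ * x) ^ (h ℕ.+ h)                  ≡⟨ *-^ (- 1ℚ) x (h ℕ.+ h) ⟩
  (- 1ℚ) ^ (h ℕ.+ h) * x ^ (h ℕ.+ h)      ≡⟨ cong (_* x ^ (h ℕ.+ h)) (sign-even h) ⟩
  1ℚ * x ^ (h ℕ.+ h)                      ≡⟨ ℚP.*-identityˡ (x ^ (h ℕ.+ h)) ⟩
  x ^ (h ℕ.+ h)                           ∎
  where
  lemma : ∀ x → - x ≡ - 1ℚ * x
  lemma = solve-∀ ring

prime-odd : ∀ N → Prime (suc N) → 2 < suc N → N ≡ N ℕ./ 2 ℕ.+ N ℕ./ 2
prime-odd N pp 2<p with N ℕ.% 2 in eq | m%n<n N 2
... | 0 | _ = trans (division 0 eq) (trans (ℕP.*-comm (N ℕ./ 2) 2) (cong (N ℕ./ 2 ℕ.+_) (ℕP.+-identityʳ (N ℕ./ 2))))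
  where
  division : ∀ r → N ℕ.% 2 ≡ r → N ≡ r ℕ.+ N ℕ./ 2 ℕ.* 2
  division r eq = trans (m≡m%n+[m/n]*n N 2) (cong (ℕ._+ N ℕ./ 2 ℕ.* 2) eq)
-- An odd N makes p = N+1 divisible by 2, which would force p = 2.
... | 1 | _ with prime⇒irreducible pp
                  (divides (suc (N ℕ./ 2)) (cong suc (trans (m≡m%n+[m/n]*n N 2) (cong (ℕ._+ N ℕ./ 2 ℕ.* 2) eq))))
...   | inj₁ ()
...   | inj₂ refl = contradiction 2<p (ℕP.<-irrefl refl)
prime-odd N pp 2<p | suc (suc _) | s≤s (s≤s ())

-- p-integral polynomials

module Localization (p : ℕ) (pp : Prime p) where

  P : ℚ
  P = ℕ→ℚ p

  Zp-denominators : ∀ {x y z} → ↧ₙ z ∣ ↧ₙ x ℕ.* ↧ₙ y → Zp p x → Zp p y → Zp p z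
  Zp-denominators {x} {y} z∣xy x∈ y∈ p∣z =
    [ x∈ , y∈ ]′ (euclidsLemma (↧ₙ x) (↧ₙ y) pp (∣-trans p∣z z∣xy))

  private
    denominator-∣ : ∀ x y z g → ↧ z ℤ.* g ≡ ↧ x ℤ.* ↧ y → ↧ₙ z ∣ ↧ₙ x ℕ.* ↧ₙ y
    denominator-∣ x y z g eq = divides ℤ.∣ g ∣ (begin
      ↧ₙ x ℕ.* ↧ₙ y          ≡⟨ sym (ℤP.abs-* (↧ x) (↧ y)) ⟩
      ℤ.∣ ↧ x ℤ.* ↧ y ∣      ≡⟨ cong ℤ.∣_∣ (sym eq) ⟩
      ℤ.∣ ↧ z ℤ.* g ∣        ≡⟨ ℤP.abs-* (↧ z) g ⟩
      ↧ₙ z ℕ.* ℤ.∣ g ∣       ≡⟨ ℕP.*-comm (↧ₙ z) ℤ.∣ g ∣ ⟩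
      ℤ.∣ g ∣ ℕ.* ↧ₙ z       ∎)

  Zp-+ : ∀ {x y} → Zp p x → Zp p y → Zp p (x + y)
  Zp-+ {x} {y} = Zp-denominators {x} {y} {x + y} (denominator-∣ x y (x + y)
    (gcd (↥ x ℤ.* ↧ y ℤ.+ ↥ y ℤ.* ↧ x) (↧ x ℤ.* ↧ y)) (ℚP.↧-+ x y))

  Zp-* : ∀ {x y} → Zp p x → Zp p y → Zp p (x * y)
  Zp-* {x} {y} = Zp-denominators {x} {y} {x * y} (denominator-∣ x y (x * y)
    (gcd (↥ x ℤ.* ↥ y) (↧ x ℤ.* ↧ y)) (ℚP.↧-* x y))

  Zp-neg : ∀ {x} → Zp p x → Zp p (- x)
  Zp-neg {x} x∈ = x∈ ∘ subst (p ∣_) (cong ℤ.∣_∣ (ℚP.↧-neg x))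

  ¬p∣1 : ¬ p ∣ 1
  ¬p∣1 p∣1 = ¬prime[1] (subst Prime (∣1⇒≡1 p∣1) pp)

  Zp-ℕ : ∀ n → Zp p (ℕ→ℚ n)
  Zp-ℕ n = subst (Zp p) (sym (ℕ→ℚ≡mkℚ n)) ¬p∣1

  Zp-inv-ℕ : ∀ n → ¬ p ∣ suc n → Zp p (inv (ℕ→ℚ (suc n)))
  Zp-inv-ℕ n = subst (Zp p ∘ inv) (sym (ℕ→ℚ≡mkℚ (suc n)))

  P≢0 : P ≢ 0ℚ
  P≢0 = ℕ→ℚ≢0 p {{prime⇒nonZero pp}}

  -- I m is the ideal pᵐℤₚ; in particular I 0 is the ring ℤₚ itself.
  record I (m : ℕ) (x : ℚ) : Set where
    constructor ideal
    field
      quotient : ℚ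
      integral : Zp p quotient
      equation : x ≡ P ^ m * quotient

  Cong⇒I : ∀ {m} x y → Cong p m x y → I m (x - y)
  Cong⇒I _ _ (z , z∈ , eq) = ideal z z∈ eq

  I⇒Cong : ∀ {m} x y → I m (x - y) → Cong p m x y
  I⇒Cong _ _ (ideal z z∈ eq) = z , z∈ , eq

  I-resp : ∀ {m x y} → x ≡ y → I m x → I m y
  I-resp = subst (I _)

  Zp⇒I : ∀ {x} → Zp p x → I 0 x
  Zp⇒I {x} x∈ = ideal x x∈ (sym (ℚP.*-identityˡ x))

  I⇒Zp : ∀ {x} → I 0 x → Zp p x
  I⇒Zp (ideal z z∈ refl) = subst (Zp p) (sym (ℚP.*-identityˡ z)) z∈

  I-ℕ : ∀ n → I 0 (ℕ→ℚ n)
  I-ℕ n = Zp⇒I (Zp-ℕ n)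

  I-0 : ∀ {m} → I m 0ℚ
  I-0 {m} = ideal 0ℚ (Zp-ℕ 0) (sym (ℚP.*-zeroʳ (P ^ m)))

  I-+ : ∀ {m x y} → I m x → I m y → I m (x + y)
  I-+ {m} (ideal w w∈ refl) (ideal z z∈ refl) =
    ideal (w + z) (Zp-+ {w} {z} w∈ z∈) (sym (ℚP.*-distribˡ-+ (P ^ m) w z))

  I-neg : ∀ {m x} → I m x → I m (- x)
  I-neg {m} (ideal z z∈ refl) = ideal (- z) (Zp-neg {z} z∈) (ℚP.neg-distribʳ-* (P ^ m) z)

  I-- : ∀ {m x y} → I m x → I m y → I m (x - y)
  I-- x∈ y∈ = I-+ x∈ (I-neg y∈)

  I-* : ∀ {m k x y} → I m x → I k y → I (m ℕ.+ k) (x * y)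
  I-* {m} {k} (ideal w w∈ refl) (ideal z z∈ refl) = ideal (w * z) (Zp-* {w} {z} w∈ z∈)
    (trans (lemma (P ^ m) (P ^ k) w z) (cong (_* (w * z)) (sym (^-+ P m k))))
    where
    lemma : ∀ a b w z → (a * w) * (b * z) ≡ (a * b) * (w * z)
    lemma = solve-∀ ring

  I-^ : ∀ {x} n → I 0 x → I 0 (x ^ n)
  I-^ zero x∈ = I-ℕ 1
  I-^ (suc n) x∈ = I-* x∈ (I-^ n x∈)

  I-P : I 1 P
  I-P = ideal 1ℚ (Zp-ℕ 1) (sym (trans (ℚP.*-identityʳ (P ^ 1)) (ℚP.*-identityʳ P)))

  I-suc⇒I : ∀ {m x} → I (suc m) x → I m x
  I-suc⇒I {m} (ideal z z∈ refl) = ideal (P * z) (Zp-* {P} {z} (Zp-ℕ p) z∈) (lemma P (P ^ m) z)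
    where
    lemma : ∀ a b z → (a * b) * z ≡ b * (a * z)
    lemma = solve-∀ ring

  I⇒I0 : ∀ {m x} → I m x → I 0 x
  I⇒I0 {zero} x∈ = x∈
  I⇒I0 {suc m} x∈ = I⇒I0 (I-suc⇒I x∈)

  -- Cancellation of a unit `n` of ℤₚ, given together with its inverse `x`.
  I-unscale : ∀ {m n} x y → n * x ≡ 1ℚ → I 0 x → I m (n * y) → I m y
  I-unscale {n = n} x y nx≡1 x∈ ny∈ = I-resp eq (I-* x∈ ny∈)
    where
    lemma : ∀ n x y → x * (n * y) ≡ (n * x) * y
    lemma = solve-∀ ring
    eq : x * (n * y) ≡ y
    eq = trans (lemma n x y) (trans (cong (_* y) nx≡1) (ℚP.*-identityˡ y))

  I-inv-ℕ : ∀ n → suc n < p → I 0 (inv (ℕ→ℚ (suc n)))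
  I-inv-ℕ n n<p = Zp⇒I (Zp-inv-ℕ n λ p∣n → ℕP.<⇒≱ n<p (∣⇒≤ p∣n))

  p∣numerator⇒I : ∀ x → I 0 x → p ∣ ℤ.∣ ↥ x ∣ → I 1 x
  p∣numerator⇒I x x∈ (divides q eq) = I-unscale {n = ℕ→ℚ (↧ₙ x)} (inv (ℕ→ℚ (↧ₙ x))) x
    (*-inv-suc (ℚ.denominator-1 x)) (Zp⇒I (Zp-inv-ℕ (ℚ.denominator-1 x) (I⇒Zp x∈)))
    (I-resp (trans (sym (*-denominator x)) (ℚP.*-comm x (ℕ→ℚ (↧ₙ x)))) (I-ℤ (↥ x) eq))
    where
    I-qp : I 1 (ℕ→ℚ (q ℕ.* p))
    I-qp = I-resp (sym (ℕ→ℚ-* q p)) (I-* (I-ℕ q) I-P)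
    I-ℤ : ∀ i → ℤ.∣ i ∣ ≡ q ℕ.* p → I 1 (i / 1)
    I-ℤ (ℤ.+ n) eq = subst (λ n → I 1 (ℕ→ℚ n)) (sym eq) I-qp
    I-ℤ -[1+ n ] eq = I-neg (subst (λ n → I 1 (ℕ→ℚ n)) (sym eq) I-qp)

  -- The denominator of `inv x` is the numerator of `x` up to sign; if p divided it, `x` would lie
  -- in pℤₚ.
  I-inv : ∀ {x} → I 0 x → ¬ I 1 x → I 0 (inv x) × (x * inv x ≡ 1ℚ)
  I-inv {x} x∈ x∉ =
      Zp⇒I (λ p∣ → x∉ (p∣numerator⇒I x x∈ (subst (p ∣_) (↧ₙ-inv x x≢0) p∣)))
    , *-inv x x≢0
    where
    x≢0 : x ≢ 0ℚ
    x≢0 refl = x∉ I-0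

  -- Polynomial functions of degree < n whose coefficients in the Newton basis
  -- 1, x, x(x-1), x(x-1)(x-2), … lie in pᵐℤₚ.
  data Poly (m : ℕ) : ℕ → (ℚ → ℚ) → Set where
    null   : ∀ {f} → (∀ x → f x ≡ 0ℚ) → Poly m 0 f
    newton : ∀ {n f} c g → I m c → Poly m n g → (∀ x → f x ≡ c + x * g (x - 1ℚ)) → Poly m (suc n) f

  Poly-ext : ∀ {m n f g} → (∀ x → f x ≡ g x) → Poly m n f → Poly m n g
  Poly-ext f≗g (null f≗0) = null λ x → trans (sym (f≗g x)) (f≗0 x)
  Poly-ext f≗g (newton c h c∈ h∈ eq) = newton c h c∈ h∈ λ x → trans (sym (f≗g x)) (eq x)

  Poly-0 : ∀ {m} n → Poly m n (λ _ → 0ℚ)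
  Poly-0 zero = null λ _ → refl
  Poly-0 (suc n) = newton 0ℚ (λ _ → 0ℚ) I-0 (Poly-0 n) (solve-∀ ring)

  Poly-const : ∀ {m c} n → I m c → Poly m (suc n) (λ _ → c)
  Poly-const {c = c} n c∈ = newton c (λ _ → 0ℚ) c∈ (Poly-0 n) (lemma c)
    where
    lemma : ∀ c x → c ≡ c + x * 0ℚ
    lemma = solve-∀ ring

  Poly-weaken : ∀ {m n k f} → n ≤ k → Poly m n f → Poly m k f
  Poly-weaken {k = k} z≤n (null f≗0) = Poly-ext (λ x → sym (f≗0 x)) (Poly-0 k)
  Poly-weaken (s≤s n≤k) (newton c g c∈ g∈ eq) = newton c g c∈ (Poly-weaken n≤k g∈) eq

  Poly-+ : ∀ {m n f g} → Poly m n f → Poly m n g → Poly m n (λ x → f x + g x)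
  Poly-+ (null f≗0) (null g≗0) = null λ x → cong₂ _+_ (f≗0 x) (g≗0 x)
  Poly-+ (newton c f′ c∈ f′∈ eq) (newton d g′ d∈ g′∈ eq′) =
    newton (c + d) _ (I-+ c∈ d∈) (Poly-+ f′∈ g′∈)
      λ x → trans (cong₂ _+_ (eq x) (eq′ x)) (lemma c d x (f′ (x - 1ℚ)) (g′ (x - 1ℚ)))
    where
    lemma : ∀ c d x u v → (c + x * u) + (d + x * v) ≡ (c + d) + x * (u + v)
    lemma = solve-∀ ring

  Poly-scale : ∀ {m n e f} → I 0 e → Poly m n f → Poly m n (λ x → e * f x)
  Poly-scale {e = e} e∈ (null f≗0) = null λ x → trans (cong (e *_) (f≗0 x)) (ℚP.*-zeroʳ e)
  Poly-scale {e = e} e∈ (newton c g c∈ g∈ eq) = newton (e * c) _ (I-* e∈ c∈) (Poly-scale e∈ g∈)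
      λ x → trans (cong (e *_) (eq x)) (lemma e c x (g (x - 1ℚ)))
    where
    lemma : ∀ e c x u → e * (c + x * u) ≡ e * c + x * (e * u)
    lemma = solve-∀ ring

  Poly-neg : ∀ {m n f} → Poly m n f → Poly m n (λ x → - f x)
  Poly-neg {f = f} f∈ = Poly-ext (λ x → lemma (f x)) (Poly-scale (I-neg (I-ℕ 1)) f∈)
    where
    lemma : ∀ y → - 1ℚ * y ≡ - y
    lemma = solve-∀ ring

  -- Passing from x to x-1 in the Newton form turns αx+β into α(x-1) + (α+β): the induction keeps α
  -- and shifts β.
  Poly-linear : ∀ {m n α β f} → I 0 α → I 0 β → Poly m n f → Poly m (suc n) (λ x → (α * x + β) * f x)
  Poly-linear {α = α} {β} α∈ β∈ (null f≗0) =
    Poly-ext (λ x → sym (trans (cong ((α * x + β) *_) (f≗0 x)) (ℚP.*-zeroʳ (α * x + β)))) (Poly-0 1)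
  Poly-linear {α = α} {β} α∈ β∈ (newton {n} c g c∈ g∈ eq) = newton (β * c) _ (I-* β∈ c∈)
      (Poly-+ (Poly-const n (I-* α∈ c∈)) (Poly-linear α∈ (I-+ α∈ β∈) g∈))
      λ x → trans (cong ((α * x + β) *_) (eq x)) (lemma α β c x (g (x - 1ℚ)))
    where
    lemma : ∀ α β c x u →
      (α * x + β) * (c + x * u) ≡ β * c + x * (α * c + (α * (x - 1ℚ) + (α + β)) * u)
    lemma = solve-∀ ring

  Poly-sum : ∀ {m n} k {f : ℕ → ℚ → ℚ} → (∀ j → j ≤ k → Poly m n (f j)) →
             Poly m n (λ x → sum0to k (λ j → f j x))
  Poly-sum zero {f} f∈ = Poly-ext (λ x → sym (sum0to-zero (λ j → f j x))) (f∈ 0 z≤n)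
  Poly-sum (suc k) {f} f∈ = Poly-ext (λ x → sym (sum0to-suc k (λ j → f j x)))
    (Poly-+ (Poly-sum k λ j j≤k → f∈ j (ℕP.m≤n⇒m≤1+n j≤k)) (f∈ (suc k) ℕP.≤-refl))

  private
    I-pred : ∀ {x} → I 0 x → I 0 (x - 1ℚ)
    I-pred x∈ = I-- x∈ (I-ℕ 1)

  Poly-value : ∀ {m n f x} → Poly m n f → I 0 x → I m (f x)
  Poly-value {x = x} (null f≗0) x∈ = I-resp (sym (f≗0 x)) I-0
  Poly-value {x = x} (newton c g c∈ g∈ eq) x∈ =
    I-resp (sym (eq x)) (I-+ c∈ (I-* x∈ (Poly-value g∈ (I-pred x∈))))

  -- The exponents add: x - y divides f(x) - f(y), with a quotient that inherits the factor pᵐ of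
  -- the coefficients. The case k = m = 1 lifts congruences modulo p to p².
  Poly-cong : ∀ {m n k f x y} → Poly m n f → I 0 x → I 0 y → I k (x - y) → I (k ℕ.+ m) (f x - f y)
  Poly-cong {x = x} {y} (null f≗0) x∈ y∈ xy = I-resp (sym (cong₂ _-_ (f≗0 x) (f≗0 y))) I-0
  Poly-cong {x = x} {y} (newton c g c∈ g∈ eq) x∈ y∈ xy =
    I-resp (sym (trans (cong₂ _-_ (eq x) (eq y)) (lemma c x y (g (x - 1ℚ)) (g (y - 1ℚ)))))
      (I-+ (I-* x∈ (Poly-cong g∈ (I-pred x∈) (I-pred y∈) (I-resp (shift x y) xy)))
           (I-* xy (Poly-value g∈ (I-pred y∈))))
    where
    lemma : ∀ c x y u v → (c + x * u) - (c + y * v) ≡ x * (u - v) + (x - y) * v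
    lemma = solve-∀ ring
    shift : ∀ x y → x - y ≡ (x - 1ℚ) - (y - 1ℚ)
    shift = solve-∀ ring

  -- `D` is built by the product rule for x·g(x-1), which keeps it in ℤₚ. It is chosen before `t`,
  -- because the same `D` has to serve for two different increments.
  Poly-derivative : ∀ {n f x} → Poly 0 n f → I 0 x →
    ∃ λ D → I 0 D × (∀ t → I 0 t → I 2 (f (x + P * t) - (f x + P * t * D)))
  Poly-derivative {x = x} (null f≗0) x∈ = 0ℚ , I-0 , λ t t∈ →
    I-resp (sym (trans (cong₂ (λ u v → u - (v + P * t * 0ℚ)) (f≗0 (x + P * t)) (f≗0 x)) (lemma P t))) I-0
    where
    lemma : ∀ q t → 0ℚ - (0ℚ + q * t * 0ℚ) ≡ 0ℚ
    lemma = solve-∀ ring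
  Poly-derivative {f = f} {x = x} (newton c g c∈ g∈ eq) x∈ with Poly-derivative g∈ (I-pred x∈)
  ... | D , D∈ , approx = g (x - 1ℚ) + x * D , I-+ (Poly-value g∈ (I-pred x∈)) (I-* x∈ D∈) , λ t t∈ →
    let Pt = P * t
        e = g (x - 1ℚ + Pt) - (g (x - 1ℚ) + Pt * D)
        Pt∈ = I-* I-P t∈
        value : f (x + Pt) ≡ c + (x + Pt) * g (x - 1ℚ + Pt)
        value = trans (eq (x + Pt)) (cong (λ y → c + (x + Pt) * g y) (shift x Pt))
    in I-resp (sym (trans (cong₂ (λ u v → u - (v + Pt * (g (x - 1ℚ) + x * D))) value (eq x))
                          (lemma c x Pt D (g (x - 1ℚ + Pt)) (g (x - 1ℚ)))))
         (I-+ (I-* (I-+ x∈ (I⇒I0 Pt∈)) (approx t t∈)) (I-* (I-* Pt∈ Pt∈) D∈))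
    where
    shift : ∀ x y → x + y - 1ℚ ≡ x - 1ℚ + y
    shift = solve-∀ ring
    lemma : ∀ c x y D u v → (c + (x + y) * u) - ((c + x * v) + y * (v + x * D)) ≡
                            (x + y) * (u - (v + y * D)) + y * y * D
    lemma = solve-∀ ring

  -- The value at 0 is the constant coefficient, and in the value at j+1 the factor j+1 is invertible.
  Poly-vanishing : ∀ {n f} → Poly 0 n f → n ≤ p → (∀ j → j < n → I 1 (f (ℕ→ℚ j))) → Poly 1 n f
  Poly-vanishing (null f≗0) _ _ = null f≗0
  Poly-vanishing {f = f} (newton c g c∈ g∈ eq) n≤p values =
    newton c g c∈′ (Poly-vanishing g∈ (ℕP.≤-trans (ℕP.n≤1+n _) n≤p) values′) eq
    where
    c∈′ : I 1 c
    c∈′ = I-resp (trans (eq 0ℚ) (lemma c (g (0ℚ - 1ℚ)))) (values 0 (s≤s z≤n))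
      where
      lemma : ∀ c u → c + 0ℚ * u ≡ c
      lemma = solve-∀ ring
    values′ : ∀ j → j < _ → I 1 (g (ℕ→ℚ j))
    values′ j j<n = I-unscale {n = ℕ→ℚ (suc j)} _ _ (*-inv-suc j)
      (I-inv-ℕ j (ℕP.≤-trans (s≤s j<n) n≤p))
      (I-resp (trans (cong (_- c) (trans (eq (ℕ→ℚ (suc j))) (cong (λ y → c + ℕ→ℚ (suc j) * g y) pred)))
                     (lemma c (ℕ→ℚ (suc j) * g (ℕ→ℚ j))))
              (I-- (values (suc j) (s≤s j<n)) c∈′))
      where
      lemma : ∀ c u → c + u - c ≡ u
      lemma = solve-∀ ring
      cancel : ∀ x → x + 1ℚ - 1ℚ ≡ x
      cancel = solve-∀ ring
      pred : ℕ→ℚ (suc j) - 1ℚ ≡ ℕ→ℚ j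
      pred = trans (cong (_- 1ℚ) (ℕ→ℚ-suc j)) (cancel (ℕ→ℚ j))

  -- Here f - g = p·R with R over ℤₚ.
  Poly-congruent-differences : ∀ {f g x y} → Poly 0 p f → Poly 0 p g →
    (∀ j → j < p → I 1 (f (ℕ→ℚ j) - g (ℕ→ℚ j))) →
    I 0 x → I 0 y → I 1 (x - y) → I 2 ((f x - g x) - (f y - g y))
  Poly-congruent-differences f∈ g∈ agree =
    Poly-cong (Poly-vanishing (Poly-+ f∈ (Poly-neg g∈)) ℕP.≤-refl agree)

-- Congruences between L, S and the Euler polynomials

-- Here N = p-1 and M = p-2. They are variables tied by equations, so that `p` is turned into a
-- successor only where a recursion has to unfold.
module Congruences (p N h M : ℕ) (pp : Prime p) (p≡ : p ≡ suc N) (N≡ : N ≡ h ℕ.+ h) (N≡M : N ≡ suc M) where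
  open Localization p pp

  P≡ : P ≡ ℕ→ℚ N + 1ℚ
  P≡ = trans (cong ℕ→ℚ p≡) (ℕ→ℚ-suc N)

  2<p : 2 < p
  2<p = subst (2 <_) (sym p≡) (s≤s (N≥2 h N≡))
    where
    N≥2 : ∀ h → N ≡ h ℕ.+ h → 2 ≤ N
    N≥2 zero eq with () ← trans (sym N≡M) eq
    N≥2 (suc h) eq = subst (2 ≤_) (sym (trans eq (cong suc (ℕP.+-suc h h)))) (s≤s (s≤s z≤n))

  ≤N⇒<p : ∀ {j} → j ≤ N → j < p
  ≤N⇒<p {j} j≤N = subst (j <_) (sym p≡) (s≤s j≤N)

  <p⇒≤N : ∀ {j} → j < p → j ≤ N
  <p⇒≤N {j} j<p = ℕP.≤-pred (subst (j <_) p≡ j<p)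

  -- Both sides are inverse to (-1)ʲ, since N and 2j are even.
  sign-N∸ : ∀ j → j ≤ N → (- 1ℚ) ^ (N ∸ j) ≡ (- 1ℚ) ^ j
  sign-N∸ j j≤N = inverse-unique ((- 1ℚ) ^ j) _ _
    (trans (sym (^-+ (- 1ℚ) j (N ∸ j)))
      (trans (cong ((- 1ℚ) ^_) (trans (ℕP.m+[n∸m]≡n j≤N) N≡)) (sign-even h)))
    (trans (sym (^-+ (- 1ℚ) j j)) (sign-even j))

  I-sum : ∀ {m} n {f} → (∀ k → k ≤ n → I m (f k)) → I m (sum0to n f)
  I-sum zero {f} f∈ = I-resp (sym (sum0to-zero f)) (f∈ 0 z≤n)
  I-sum (suc n) {f} f∈ = I-resp (sym (sum0to-suc n f))
    (I-+ (I-sum n λ k k≤n → f∈ k (ℕP.m≤n⇒m≤1+n k≤n)) (f∈ (suc n) ℕP.≤-refl))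

  I-sum-last : ∀ {m} n {f} → (∀ k → k < n → I m (f k)) → I m (sum0to n f - f n)
  I-sum-last zero {f} _ = I-resp (sym (trans (cong (_- f 0) (sum0to-zero f)) (ℚP.+-inverseʳ (f 0)))) I-0
  I-sum-last (suc n) {f} f∈ = I-resp
    (sym (trans (cong (_- f (suc n)) (sum0to-suc n f)) (lemma (sum0to n f) (f (suc n)))))
    (I-sum n λ k k≤n → f∈ k (s≤s k≤n))
    where
    lemma : ∀ x y → x + y - y ≡ x
    lemma = solve-∀ ring

  L S V : ℚ → ℚ
  L = legendreSum h
  S = geometricSum N
  V x = eulerPoly N (- x)

  binom-Poly : ∀ k → k < p → Poly 0 (suc k) (λ x → binom x k)
  binom-Poly zero _ = Poly-const 0 (I-ℕ 1)
  binom-Poly (suc k) k<p = Poly-ext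
    (λ x → sym (trans (binom-suc x k) (lemma x (ℕ→ℚ k) (binom x k) (1/suc k))))
    (Poly-scale (I-inv-ℕ k k<p)
      (Poly-linear (I-ℕ 1) (I-neg (I-ℕ k)) (binom-Poly k (ℕP.<⇒≤ k<p))))
    where
    lemma : ∀ x n b v → b * (x - n) * v ≡ v * ((1ℚ * x + - n) * b)
    lemma = solve-∀ ring

  S-Poly : Poly 0 p S
  S-Poly = Poly-sum N λ k k≤N → Poly-ext (λ x → ℚP.*-comm ((- ℕ→ℚ 2) ^ k) (binom x k))
    (Poly-scale (I-^ k (I-neg (I-ℕ 2))) (Poly-weaken (≤N⇒<p k≤N) (binom-Poly k (≤N⇒<p k≤N))))

  -- Each step adds two linear factors and divides by (k+1)². At k = h the bound is 2h+1 = p, the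
  -- largest that `Poly-vanishing` accepts.
  L-term-Poly : ∀ k → k < p → Poly 0 (suc (k ℕ.+ k)) (λ x → binom x k * binom (- 1ℚ - x) k)
  L-term-Poly zero _ = Poly-const 0 (I-ℕ 1)
  L-term-Poly (suc k) k<p = subst (λ n → Poly 0 (suc (suc n)) f) (sym (ℕP.+-suc k k)) (Poly-ext
    (λ x → sym (trans (cong₂ _*_ (binom-suc x k) (binom-suc (- 1ℚ - x) k))
      (lemma x (ℕ→ℚ k) (binom x k) (binom (- 1ℚ - x) k) (1/suc k))))
    (Poly-scale (I-* (I-inv-ℕ k k<p) (I-inv-ℕ k k<p))
      (Poly-linear (I-neg (I-ℕ 1)) (I-- (I-neg (I-ℕ 1)) (I-ℕ k))
        (Poly-linear (I-ℕ 1) (I-neg (I-ℕ k)) (L-term-Poly k (ℕP.<⇒≤ k<p))))))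
    where
    f : ℚ → ℚ
    f x = binom x (suc k) * binom (- 1ℚ - x) (suc k)
    lemma : ∀ x n b c v → b * (x - n) * v * (c * (- 1ℚ - x - n) * v) ≡
      v * v * ((- 1ℚ * x + (- 1ℚ - n)) * ((1ℚ * x + - n) * (b * c)))
    lemma = solve-∀ ring

  h≤N : h ≤ N
  h≤N = subst (h ≤_) (sym N≡) (ℕP.m≤m+n h h)

  L-Poly : Poly 0 p L
  L-Poly = Poly-sum h λ k k≤h → Poly-weaken
    (≤N⇒<p (ℕP.≤-trans (ℕP.+-mono-≤ k≤h k≤h) (ℕP.≤-reflexive (sym N≡))))
    (L-term-Poly k (≤N⇒<p (ℕP.≤-trans k≤h h≤N)))

  S-value : ∀ j → j ≤ N → S (ℕ→ℚ j) ≡ (- 1ℚ) ^ j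
  S-value = geometricSum-value N

  -- L(j - p) = L(p - 1 - j), and p - 1 - j is a natural number ≤ h.
  L-value-negative : ∀ j → h < j → j ≤ N → L (ℕ→ℚ j - P) ≡ (- 1ℚ) ^ j
  L-value-negative j h<j j≤N = begin
    L (ℕ→ℚ j - P)           ≡⟨ sym (legendreSum-reflect h (ℕ→ℚ j - P)) ⟩
    L (- 1ℚ - (ℕ→ℚ j - P))  ≡⟨ cong L reflected ⟩
    L (ℕ→ℚ (N ∸ j))         ≡⟨ legendreSum-value h (N ∸ j) N∸j≤h ⟩
    (- 1ℚ) ^ (N ∸ j)        ≡⟨ sign-N∸ j j≤N ⟩
    (- 1ℚ) ^ j              ∎
    where
    lemma : ∀ x y → - 1ℚ - (x - (x + y + 1ℚ)) ≡ y
    lemma = solve-∀ ring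
    reflected : - 1ℚ - (ℕ→ℚ j - P) ≡ ℕ→ℚ (N ∸ j)
    reflected = trans
      (cong (λ q → - 1ℚ - (ℕ→ℚ j - q)) (trans P≡ (cong (_+ 1ℚ)
        (trans (cong ℕ→ℚ (sym (ℕP.m+[n∸m]≡n j≤N))) (ℕ→ℚ-+ j (N ∸ j))))))
      (lemma (ℕ→ℚ j) (ℕ→ℚ (N ∸ j)))
    N∸j≤h : N ∸ j ≤ h
    N∸j≤h = ℕP.m≤n+o⇒m∸n≤o N j
      (subst (_≤ j ℕ.+ h) (sym N≡) (ℕP.+-monoˡ-≤ h (ℕP.<⇒≤ h<j)))

  I-minus-P : ∀ x → I 1 (x - (x - P))
  I-minus-P x = I-resp (lemma x P) I-P
    where
    lemma : ∀ x q → q ≡ x - (x - q)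
    lemma = solve-∀ ring

  I-difference-0 : ∀ {m x y} → x ≡ y → I m (x - y)
  I-difference-0 {x = x} refl = I-resp (sym (ℚP.+-inverseʳ x)) I-0

  I-≡ : ∀ {m y z} x → I m (x - y) → y ≡ z → I m (x - z)
  I-≡ _ x∈ refl = x∈

  L-value-mod : ∀ j → j < p → I 1 (L (ℕ→ℚ j) - S (ℕ→ℚ j))
  L-value-mod j j<p with j ℕ.≤? h
  ... | yes j≤h = I-difference-0 (trans (legendreSum-value h j j≤h) (sym (S-value j (<p⇒≤N j<p))))
  ... | no j≰h = I-≡ (L (ℕ→ℚ j)) (Poly-cong L-Poly (I-ℕ j) (I-- (I-ℕ j) (I-ℕ p)) (I-minus-P (ℕ→ℚ j)))
    (trans (L-value-negative j (ℕP.≰⇒> j≰h) (<p⇒≤N j<p)) (sym (S-value j (<p⇒≤N j<p))))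

  L-S : ∀ {x y} → I 0 x → I 0 y → I 1 (x - y) → I 2 ((L x - S x) - (L y - S y))
  L-S = Poly-congruent-differences L-Poly S-Poly L-value-mod

  L-S-negative : ∀ {a} r → I 0 a → r < p → h < r → I 1 (a - ℕ→ℚ r) →
    I 2 ((L a - S a) - ((- 1ℚ) ^ r - S (ℕ→ℚ r - P)))
  L-S-negative {a} r a∈ r<p h<r a≡r = I-≡ (L a - S a)
    (L-S a∈ (I-- (I-ℕ r) (I-ℕ p)) (I-resp (lemma a (ℕ→ℚ r) P) (I-+ a≡r I-P)))
    (cong (_- S (ℕ→ℚ r - P)) (L-value-negative r h<r (<p⇒≤N r<p)))
    where
    lemma : ∀ a r q → a - r + q ≡ a - (r - q)
    lemma = solve-∀ ring

  small-residue : ∀ {a} r → I 0 a → r < p → r ≤ h → I 1 (a - ℕ→ℚ r) → I 2 (L a - S a)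
  small-residue {a} r a∈ r<p r≤h a≡r = I-resp
    (trans (cong (λ z → L a - S a - (z - S (ℕ→ℚ r)))
      (trans (legendreSum-value h r r≤h) (sym (S-value r (<p⇒≤N r<p)))))
      (lemma (L a - S a) (S (ℕ→ℚ r))))
    (L-S a∈ (I-ℕ r) a≡r)
    where
    lemma : ∀ x y → x - (y - y) ≡ x
    lemma = solve-∀ ring

  -- Put s = (-1)ʳ. Modulo p², L(a) ≡ S(a) + s - S(r-p) ≡ S(a) + pD, while S(a) - s ≡ ptD gives pD ≡
  -- i·(S(a) - s).
  large-residue : ∀ {a t i} r → I 0 a → I 0 t → I 0 i → r < p → h < r → a ≡ ℕ→ℚ r + P * t → t * i ≡ 1ℚ →
    I 2 (L a - ((1ℚ + i) * S a - (- 1ℚ) ^ r * i))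
  large-residue {a} {t} {i} r a∈ t∈ i∈ r<p h<r refl ti≡1 with Poly-derivative S-Poly (I-ℕ r)
  ... | D , D∈ , approx = I-resp
    (sym (trans (lemma (L a) (S a) (S (x - P)) s i t P D)
      (cong (λ z → (((L a - S a) - (s - S (x - P))) - (S (x - P) - (s + P * - 1ℚ * D)))
                   - i * (S a - (s + P * t * D)) + P * D * (1ℚ - z)) ti≡1)))
    (I-+ (I-- (I-- (L-S-negative r a∈ r<p h<r (I-resp (difference x (P * t)) (I-* I-P t∈))) approx₋₁)
              (I-* i∈ approxₜ))
         -- The remaining term `P * D * (1ℚ - t * i)`, with `t * i` already replaced by 1.
         (I-resp (sym (ℚP.*-zeroʳ (P * D))) I-0))
    where
    x = ℕ→ℚ r
    s = (- 1ℚ) ^ r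
    lemma : ∀ La Sa Sr s i t q D → La - ((1ℚ + i) * Sa - s * i) ≡
      (((La - Sa) - (s - Sr)) - (Sr - (s + q * - 1ℚ * D))) - i * (Sa - (s + q * t * D)) + q * D * (1ℚ - t * i)
    lemma = solve-∀ ring
    difference : ∀ x y → y ≡ x + y - x
    difference = solve-∀ ring
    negate : ∀ x q → x + q * - 1ℚ ≡ x - q
    negate = solve-∀ ring
    approxₜ : I 2 (S a - (s + P * t * D))
    approxₜ = I-≡ (S a) (approx t t∈) (cong (_+ P * t * D) (S-value r (<p⇒≤N r<p)))
    approx₋₁ : I 2 (S (x - P) - (s + P * - 1ℚ * D))
    approx₋₁ = I-resp (cong₂ (λ y z → S y - (z + P * - 1ℚ * D)) (negate x P) (S-value r (<p⇒≤N r<p)))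
      (approx (- 1ℚ) (I-neg (I-ℕ 1)))

  -- Integrality and first-order expansion of Euler polynomials

  inv-2^-integral : ∀ n → I 0 (inv (ℕ→ℚ 2 ^ n))
  inv-2^-integral n = I-resp
    (inverse-unique (ℕ→ℚ 2 ^ n) (1/suc 1 ^ n) (inv (ℕ→ℚ 2 ^ n))
      (trans (sym (*-^ (ℕ→ℚ 2) (1/suc 1) n)) (ones n)) (2^-inv n))
    (I-^ n (I-inv-ℕ 1 2<p))
    where
    ones : ∀ n → (ℕ→ℚ 2 * 1/suc 1) ^ n ≡ 1ℚ
    ones zero = refl
    ones (suc n) = cong (1ℚ *_) (ones n)

  -- It is stated for every fuel, sufficient or not: writing `sum1to` as `sum0to` minus its term at
  -- 0 brings in `E' f (suc m)`, whose fuel may be too small.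
  I-E' : ∀ f n → I 0 (E' f n)
  I-E' zero n = I-0
  I-E' (suc f) zero = I-ℕ 1
  I-E' (suc f) (suc m) = I-neg (I-resp (lemma (g 0) _ _ (sum1to≡ (suc m ℕ./ 2) g))
    (I-- (I-sum (suc m ℕ./ 2) λ k _ → g∈ k) (g∈ 0)))
    where
    g : ℕ → ℚ
    g k = ℕ→ℚ (suc m C (2 ℕ.* k)) * E' f (suc m ∸ 2 ℕ.* k)
    g∈ : ∀ k → I 0 (g k)
    g∈ k = I-* (I-ℕ (suc m C (2 ℕ.* k))) (I-E' f (suc m ∸ 2 ℕ.* k))
    cancel : ∀ x y → x + y - x ≡ y
    cancel = solve-∀ ring
    lemma : ∀ x y z → x + y ≡ z → z - x ≡ y
    lemma x y z refl = cancel x y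

  I-eulerNumber : ∀ n → I 0 (eulerNumber n)
  I-eulerNumber n = I-E' (suc n) n

  I-conv : ∀ {a b} → (∀ n → I 0 (a n)) → (∀ n → I 0 (b n)) → ∀ n → I 0 (conv a b n)
  I-conv a∈ b∈ zero = I-* (a∈ 0) (b∈ 0)
  I-conv a∈ b∈ (suc n) = I-+ (I-conv (λ k → a∈ (suc k)) b∈ n) (I-conv a∈ (λ k → b∈ (suc k)) n)

  -- This is multiplication by exp(yu) = 1 + yu + ..., where all later terms carry y², hence p².
  conv-^-mod : ∀ a y → (∀ n → I 0 (a n)) → I 1 y → ∀ m →
    I 2 (conv a (y ^_) (suc m) - (a (suc m) + ℕ→ℚ (suc m) * y * a m))
  conv-^-mod a y a∈ y∈ zero = I-resp (sym (lemma (a 0) (a 1) y)) I-0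
    where
    lemma : ∀ x z y → (z * 1ℚ + x * (y * 1ℚ)) - (z + 1ℚ * y * x) ≡ 0ℚ
    lemma = solve-∀ ring
  conv-^-mod a y a∈ y∈ (suc m) = I-resp
    (sym (trans (cong₂ (λ u v → (conv (∂ a) (y ^_) (suc m) + u) - (a (suc (suc m)) + v * y * a (suc m)))
                  (conv-scaleʳ y a (y ^_) (suc m)) (ℕ→ℚ-suc (suc m)))
           (lemma (conv (∂ a) (y ^_) (suc m)) (conv a (y ^_) (suc m)) (a (suc (suc m)))
                  (a (suc m)) (a m) y (ℕ→ℚ (suc m)))))
    (I-+ (conv-^-mod (∂ a) y (λ n → a∈ (suc n)) y∈ m)
         (I-* y∈ (I-+ (I-suc⇒I (conv-^-mod a y a∈ y∈ m))
                      (I-* (I-* (I-ℕ (suc m)) y∈) (a∈ m)))))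
    where
    lemma : ∀ u v a₂ a₁ a₀ y n → (u + y * v) - (a₂ + (n + 1ℚ) * y * a₁) ≡
      (u - (a₂ + n * y * a₁)) + y * ((v - (a₁ + n * y * a₀)) + n * y * a₀)
    lemma = solve-∀ ring

  -- Adding P to x multiplies the generating function by exp(2Pu). The 2 in its linear term lowers
  -- the power of 2 in the denominator by one, as `eulerPoly m` requires.
  eulerPoly-derivative : ∀ m x → I 0 x →
    I 2 (eulerPoly (suc m) (x + P) - (eulerPoly (suc m) x + ℕ→ℚ (suc m) * P * eulerPoly m x))
  eulerPoly-derivative m x x∈ = I-resp
    (sym (begin
      eulerPoly (suc m) (x + P) - (eulerPoly (suc m) x + ℕ→ℚ (suc m) * P * eulerPoly m x)
        ≡⟨ cong₂ _-_ (trans (eulerPoly≡conv (suc m) (x + P)) (cong (i′ *_) expand))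
             (cong₂ (λ u v → u + ℕ→ℚ (suc m) * P * v) (eulerPoly≡conv (suc m) x)
               (trans (eulerPoly≡conv m x) (cong (_* a m) (sym (inv-2^-suc m))))) ⟩
      i′ * conv a ((2ℚ * P) ^_) (suc m) - (i′ * a (suc m) + ℕ→ℚ (suc m) * P * (i′ * 2ℚ * a m))
        ≡⟨ lemma i′ (conv a ((2ℚ * P) ^_) (suc m)) (a (suc m)) (a m) (ℕ→ℚ (suc m)) P ⟩
      i′ * (conv a ((2ℚ * P) ^_) (suc m) - (a (suc m) + ℕ→ℚ (suc m) * (2ℚ * P) * a m)) ∎))
    (I-* (inv-2^-integral (suc m)) (conv-^-mod a (2ℚ * P) a∈ (I-* (I-ℕ 2) I-P) m))
    where
    E = eulerNumber
    i′ = inv (ℕ→ℚ 2 ^ suc m)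
    y = ℕ→ℚ 2 * x - 1ℚ
    a : ℕ → ℚ
    a = conv E (y ^_)
    a∈ : ∀ n → I 0 (a n)
    a∈ = I-conv I-eulerNumber λ n → I-^ n (I-- (I-* (I-ℕ 2) x∈) (I-ℕ 1))
    shift : ∀ x q → 2ℚ * (x + q) - 1ℚ ≡ (2ℚ * x - 1ℚ) + 2ℚ * q
    shift = solve-∀ ring
    expand : conv E ((ℕ→ℚ 2 * (x + P) - 1ℚ) ^_) (suc m) ≡ conv a ((2ℚ * P) ^_) (suc m)
    expand = trans
      (conv-cong {a = E} (λ _ → refl)
        (λ k → trans (cong (_^ k) (shift x P)) (sym (conv-^ y (2ℚ * P) k))) (suc m))
      (sym (conv-assoc E (y ^_) ((2ℚ * P) ^_) (suc m)))
    lemma : ∀ i u a₁ a₀ n q → i * u - (i * a₁ + n * q * (i * 2ℚ * a₀)) ≡ i * (u - (a₁ + n * (2ℚ * q) * a₀))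
    lemma = solve-∀ ring

  ^-Poly : ∀ {α β} → I 0 α → I 0 β → ∀ n → Poly 0 (suc n) (λ x → (α * x + β) ^ n)
  ^-Poly α∈ β∈ zero = Poly-const 0 (I-ℕ 1)
  ^-Poly α∈ β∈ (suc n) = Poly-linear α∈ β∈ (^-Poly α∈ β∈ n)

  eulerPoly-neg-Poly : ∀ n → Poly 0 (suc n) (λ x → eulerPoly n (- x))
  eulerPoly-neg-Poly n = Poly-scale (inv-2^-integral n) (Poly-sum n λ r r≤n → Poly-ext
    (λ x → trans (cong (λ y → ℕ→ℚ (n C r) * eulerNumber r * y ^ (n ∸ r)) (affine x))
                 (lemma (ℕ→ℚ (n C r)) (eulerNumber r) ((ℕ→ℚ 2 * - x - 1ℚ) ^ (n ∸ r))))
    (Poly-scale (I-* (I-ℕ (n C r)) (I-eulerNumber r))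
      (Poly-weaken (s≤s (ℕP.m∸n≤m n r)) (^-Poly (I-neg (I-ℕ 2)) (I-neg (I-ℕ 1)) (n ∸ r)))))
    where
    affine : ∀ x → - 2ℚ * x + - 1ℚ ≡ 2ℚ * - x - 1ℚ
    affine = solve-∀ ring
    lemma : ∀ c e y → c * e * y ≡ c * y * e
    lemma = solve-∀ ring

  -- Fermat's little theorem

  p∣pCk : ∀ k → k < N → I 1 (ℕ→ℚ (p C suc k))
  p∣pCk k k<N = I-resp (sym (trans (cong (λ q → ℕ→ℚ (q C suc k)) p≡)
      (trans (C-absorption N k) (cong (λ q → ℕ→ℚ (N C k) * ℕ→ℚ q * 1/suc k) (sym p≡)))))
    (I-* (I-* (I-ℕ (N C k)) I-P) (I-inv-ℕ k (≤N⇒<p k<N)))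

  conv-mod-p : ∀ a b → (∀ n → I 0 (a n)) → (∀ n → I 0 (b n)) → I 1 (conv a b p - (b p * a 0 + b 0 * a p))
  -- Only the index `p` of the convolution is transported to `suc N`; the ideal `I 1` keeps its own
  -- `p`.
  conv-mod-p a b a∈ b∈ = subst
    (λ q → (∀ k → k < N → I 1 (ℕ→ℚ (q C suc k))) → I 1 (conv a b q - (b q * a 0 + b 0 * a q)))
    (sym p≡) main p∣pCk
    where
    f : ℕ → ℚ
    f r = ℕ→ℚ (suc N C r) * b (suc N ∸ r) * a r
    lemma : ∀ x y s c → (1ℚ * x * y + s) - (x * y + c) ≡ s - 1ℚ * c
    lemma = solve-∀ ring
    last : f (suc N) ≡ 1ℚ * (b 0 * a (suc N))
    last = trans (cong₂ (λ c k → ℕ→ℚ c * b k * a (suc N)) (nCn≡1 (suc N)) (ℕP.n∸n≡0 N))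
      (ℚP.*-assoc 1ℚ (b 0) (a (suc N)))
    main : (∀ k → k < N → I 1 (ℕ→ℚ (suc N C suc k))) →
           I 1 (conv a b (suc N) - (b (suc N) * a 0 + b 0 * a (suc N)))
    main C∈ = I-resp
      (sym (trans (cong (_- (b (suc N) * a 0 + b 0 * a (suc N)))
             (trans (sym (conv≡sum a b (suc N))) (sum0to-head N f)))
        (trans (lemma (b (suc N)) (a 0) (sum0to N (λ k → f (suc k))) (b 0 * a (suc N)))
          (cong (λ z → sum0to N (λ k → f (suc k)) - z) (sym last)))))
      (I-sum-last N λ k k<N → I-* (I-* (C∈ k k<N) (b∈ (N ∸ k))) (a∈ (suc k)))

  -- Induction on n: only the two end terms of (n+1)ᵖ survive modulo p.
  fermat : ∀ n → I 1 (ℕ→ℚ n ^ p - ℕ→ℚ n)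
  fermat zero = I-resp (sym (trans (cong (λ q → 0ℚ ^ q - 0ℚ) p≡) (lemma (0ℚ ^ N)))) I-0
    where
    lemma : ∀ x → 0ℚ * x - 0ℚ ≡ 0ℚ
    lemma = solve-∀ ring
  fermat (suc n) = I-resp
    (sym (trans (cong₂ _-_ (trans (cong (_^ p) (ℕ→ℚ-suc n)) (sym (conv-^ x 1ℚ p))) (ℕ→ℚ-suc n))
      (trans (cong (λ o → conv (x ^_) (1ℚ ^_) p - (x + o)) (sym (ones p)))
             (lemma (conv (x ^_) (1ℚ ^_) p) x (x ^ p) (1ℚ ^ p)))))
    (I-+ (conv-mod-p (x ^_) (1ℚ ^_) (λ k → I-^ k (I-ℕ n)) (λ k → I-^ k (I-ℕ 1))) (fermat n))
    where
    x = ℕ→ℚ n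
    ones : ∀ n → 1ℚ ^ n ≡ 1ℚ
    ones zero = refl
    ones (suc n) = trans (ℚP.*-identityˡ (1ℚ ^ n)) (ones n)
    lemma : ∀ c x xp o → c - (x + o) ≡ (c - (o * 1ℚ + 1ℚ * xp)) + (xp - x)
    lemma = solve-∀ ring

  fermat-unit : ∀ n → suc n < p → I 1 (ℕ→ℚ (suc n) ^ N - 1ℚ)
  fermat-unit n n<p = I-unscale {n = x} (1/suc n) (x ^ N - 1ℚ) (*-inv-suc n) (I-inv-ℕ n n<p)
    (I-resp (trans (cong (λ q → x ^ q - x) p≡) (lemma x (x ^ N))) (fermat (suc n)))
    where
    x = ℕ→ℚ (suc n)
    lemma : ∀ x y → x * y - x ≡ x * (y - 1ℚ)
    lemma = solve-∀ ring

  -- The Euler polynomials of degrees p-1 and p-2 against S and L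

  V-shift : ∀ n → V (ℕ→ℚ n) + V (ℕ→ℚ (suc n)) ≡ 2ℚ * ℕ→ℚ (suc n) ^ N
  V-shift n = begin
    V (ℕ→ℚ n) + V x
      ≡⟨ cong (λ y → eulerPoly N y + V x) (trans (lemma (ℕ→ℚ n)) (cong (λ y → - y + 1ℚ) (sym (ℕ→ℚ-suc n)))) ⟩
    eulerPoly N (- x + 1ℚ) + eulerPoly N (- x)
      ≡⟨ ℚP.+-comm (eulerPoly N (- x + 1ℚ)) (eulerPoly N (- x)) ⟩
    eulerPoly N (- x) + eulerPoly N (- x + 1ℚ)
      ≡⟨ eulerPoly-shift N (- x) ⟩
    2ℚ * (- x) ^ N
      -- N is even, so the sign brought in by the reflection disappears.
      ≡⟨ cong (2ℚ *_) (trans (cong ((- x) ^_) N≡) (trans (neg-^-even h x) (cong (x ^_) (sym N≡)))) ⟩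
    2ℚ * x ^ N ∎
    where
    x = ℕ→ℚ (suc n)
    lemma : ∀ y → - y ≡ - (y + 1ℚ) + 1ℚ
    lemma = solve-∀ ring

  V-Poly : Poly 0 p V
  V-Poly = subst (λ n → Poly 0 n V) (sym p≡) (eulerPoly-neg-Poly N)

  -- By Fermat, V(n) + V(n+1) ≡ 2 for n < N, so V - 1 changes sign at each step. The constant V(0)
  -- stays in the statement because its value is deduced from the case n = N.
  V-alternates : ∀ n → n ≤ N → I 1 ((V (ℕ→ℚ n) - 1ℚ) - (- 1ℚ) ^ n * (V 0ℚ - 1ℚ))
  V-alternates zero _ = I-resp (sym (lemma (V 0ℚ))) I-0
    where
    lemma : ∀ v → (v - 1ℚ) - 1ℚ * (v - 1ℚ) ≡ 0ℚ
    lemma = solve-∀ ring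
  V-alternates (suc n) n<N = I-resp
    (lemma (V (ℕ→ℚ n)) (V (ℕ→ℚ (suc n))) (ℕ→ℚ (suc n) ^ N) ((- 1ℚ) ^ n) (V 0ℚ) (V-shift n))
    (I-- (I-* (I-ℕ 2) (fermat-unit n (≤N⇒<p n<N))) (V-alternates n (ℕP.<⇒≤ n<N)))
    where
    identity : ∀ v w s o → ((v + w) - 2ℚ) - ((v - 1ℚ) - s * (o - 1ℚ)) ≡ (w - 1ℚ) - - 1ℚ * s * (o - 1ℚ)
    identity = solve-∀ ring
    distrib : ∀ e → 2ℚ * (e - 1ℚ) ≡ 2ℚ * e - 2ℚ
    distrib = solve-∀ ring
    lemma : ∀ v w e s o → v + w ≡ 2ℚ * e →
      2ℚ * (e - 1ℚ) - ((v - 1ℚ) - s * (o - 1ℚ)) ≡ (w - 1ℚ) - - 1ℚ * s * (o - 1ℚ)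
    lemma v w e s o eq = trans
      (cong (_- ((v - 1ℚ) - s * (o - 1ℚ))) (trans (distrib e) (cong (_- 2ℚ) (sym eq)))) (identity v w s o)

  -- V(p-1) ≡ V(0) by alternation, V(p) ≡ V(0) by periodicity, and V(p-1) + V(p) ≡ 0.
  V-0 : I 1 (V 0ℚ)
  V-0 = I-unscale {n = ℕ→ℚ 2} (1/suc 1) (V 0ℚ) (*-inv-suc 1) (I-inv-ℕ 1 2<p) (I-resp
    (lemma (V (ℕ→ℚ N)) (V P) (V 0ℚ) (P ^ N) ((- 1ℚ) ^ N) shift (trans (cong ((- 1ℚ) ^_) N≡) (sign-even h)))
    (I-- (I-- (I-* (I-ℕ 2) P^N∈) (V-alternates N ℕP.≤-refl))
         (Poly-cong V-Poly (I-ℕ p) (I-ℕ 0) (I-resp (sym (ℚP.+-identityʳ P)) I-P))))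
    where
    P^N∈ : I 1 (P ^ N)
    P^N∈ = subst (λ n → I 1 (P ^ n)) (sym N≡M) (I-* I-P (I-^ M (I-ℕ p)))
    shift : V (ℕ→ℚ N) + V P ≡ 2ℚ * P ^ N
    shift = subst (λ q → V (ℕ→ℚ N) + V (ℕ→ℚ q) ≡ 2ℚ * ℕ→ℚ q ^ N) (sym p≡) (V-shift N)
    identity : ∀ v w o → (v + w) - ((v - 1ℚ) - 1ℚ * (o - 1ℚ)) - (w - o) ≡ 2ℚ * o
    identity = solve-∀ ring
    lemma : ∀ v w o e s → v + w ≡ 2ℚ * e → s ≡ 1ℚ →
      2ℚ * e - ((v - 1ℚ) - s * (o - 1ℚ)) - (w - o) ≡ 2ℚ * o
    lemma v w o e s eq refl = trans (cong (λ z → z - ((v - 1ℚ) - 1ℚ * (o - 1ℚ)) - (w - o)) (sym eq)) (identity v w o)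

  S-V-value-mod : ∀ j → j < p → I 1 (S (ℕ→ℚ j) - (1ℚ + - V (ℕ→ℚ j)))
  S-V-value-mod j j<p = I-resp
    (trans (lemma (V (ℕ→ℚ j)) ((- 1ℚ) ^ j) (V 0ℚ))
           (cong (_- (1ℚ + - V (ℕ→ℚ j))) (sym (S-value j (<p⇒≤N j<p)))))
    (I-+ (V-alternates j (<p⇒≤N j<p)) (I-* (I-^ j (I-neg (I-ℕ 1))) V-0))
    where
    lemma : ∀ v s o → ((v - 1ℚ) - s * (o - 1ℚ)) + s * o ≡ s - (1ℚ + - v)
    lemma = solve-∀ ring

  S-V : ∀ {x y} → I 0 x → I 0 y → I 1 (x - y) → I 2 ((S x - (1ℚ + - V x)) - (S y - (1ℚ + - V y)))
  S-V = Poly-congruent-differences S-Poly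
    (Poly-+ (Poly-weaken (ℕP.<⇒≤ (ℕP.<-trans (s≤s (s≤s z≤n)) 2<p)) (Poly-const 0 (I-ℕ 1))) (Poly-neg V-Poly))
    S-V-value-mod

  -- The linear coefficient is N·p = p² - p, and its p² part is discarded.
  V-derivative : ∀ x → I 0 x → I 2 ((V (x - P) - V x) + P * eulerPoly M (- x))
  V-derivative x x∈ = I-resp
    (trans (cong₂ (λ y n → (eulerPoly N y - (V x + n * P * e)) + P * P * e) (point x P) N≡P-1)
           (lemma (V (x - P)) (V x) P e))
    (I-+ (subst (λ n → I 2 (eulerPoly n (- x + P) - (eulerPoly n (- x) + ℕ→ℚ n * P * e))) (sym N≡M)
           (eulerPoly-derivative M (- x) (I-neg x∈)))
         (I-* (I-* I-P I-P) (Poly-value (eulerPoly-neg-Poly M) x∈)))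
    where
    e = eulerPoly M (- x)
    point : ∀ x q → - x + q ≡ - (x - q)
    point = solve-∀ ring
    cancel : ∀ x → x ≡ x + 1ℚ - 1ℚ
    cancel = solve-∀ ring
    N≡P-1 : ℕ→ℚ N ≡ P - 1ℚ
    N≡P-1 = trans (cancel (ℕ→ℚ N)) (cong (_- 1ℚ) (sym P≡))
    lemma : ∀ w v q e → (w - (v + (q - 1ℚ) * q * e)) + q * q * e ≡ (w - v) + q * e
    lemma = solve-∀ ring

  -- Modulo p², S(a) ≡ S(r) = (-1)ʳ, so L(a) ≡ (-1)ʳ + S(r) - S(r-p). That difference is V(r-p) -
  -- V(r) ≡ -p·Eₚ₋₂(-r), and the factor p allows r to be replaced by a.
  large-residue-0 : ∀ {a} r → I 0 a → r < p → h < r → I 2 (a - ℕ→ℚ r) →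
    I 2 (L a - ((- 1ℚ) ^ r - P * eulerPoly M (- a)))
  large-residue-0 {a} r a∈ r<p h<r a≡r = I-resp
    (trans (cong (λ z → (((L a - S a) - (s - S y)) + (S a - z) + ((z - (1ℚ + - V x)) - (S y - (1ℚ + - V y)))
             + ((V y - V x) + P * eulerPoly M (- x))) + P * (eulerPoly M (- a) - eulerPoly M (- x)))
             (S-value r (<p⇒≤N r<p)))
      (lemma (L a) (S a) (S y) s (V x) (V y) P (eulerPoly M (- a)) (eulerPoly M (- x))))
    (I-+ (I-+ (I-+ (I-+ (L-S-negative r a∈ r<p h<r (I-suc⇒I a≡r))
                        (Poly-cong S-Poly a∈ x∈ a≡r))
                   (S-V x∈ (I-- x∈ (I-ℕ p)) (I-minus-P x)))
              (V-derivative x x∈))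
         (I-* I-P (Poly-cong (eulerPoly-neg-Poly M) a∈ x∈ (I-suc⇒I a≡r))))
    where
    x = ℕ→ℚ r
    y = x - P
    s = (- 1ℚ) ^ r
    x∈ = I-ℕ r
    lemma : ∀ La Sa Sr s v w q ea ex →
      (((La - Sa) - (s - Sr)) + (Sa - s) + ((s - (1ℚ + - v)) - (Sr - (1ℚ + - w))) + ((w - v) + q * ex))
        + q * (ea - ex) ≡ La - (s - q * ea)
    lemma = solve-∀ ring

theorem3p1 : (p : ℕ) → Prime p → 3 < p →
    (a : ℚ) → Zp p a → ¬ Cong p 1 a (ℕ→ℚ 0) →
    (r : ℕ) → r < p → Cong p 1 a (ℕ→ℚ r) →
      let t = (a - ℕ→ℚ r) * inv (ℕ→ℚ p)
          h = (p ∸ 1) ℕ./ 2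
          L = sum0to h (λ k → binom a k * binom (- 1ℚ - a) k)
          S = sum0to (p ∸ 1) (λ k → binom a k * ((- ℕ→ℚ 2) ^ k))
          sgn = (- 1ℚ) ^ r
      in (r ≤ h → Cong p 2 L S)
         × (r > h → ¬ Cong p 1 t (ℕ→ℚ 0) →
              Cong p 2 L ((1ℚ + inv t) * S - sgn * inv t))
         × (r > h → Cong p 1 t (ℕ→ℚ 0) →
              Cong p 2 L (sgn - ℕ→ℚ p * eulerPoly (p ∸ 2) (- a)))
theorem3p1 p@(suc (suc M)) pp 3<p a a∈ _ r r<p a≡r@(z , z∈ , a-r≡) =
    (λ r≤h → I⇒Cong (L a) (S a) (small-residue r a∈′ r<p r≤h (Cong⇒I a (ℕ→ℚ r) a≡r)))
  , (λ r>h t≢0 →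
      let i∈ , t*i≡1 = I-inv t∈ (λ t∈ₚ → t≢0 (I⇒Cong t (ℕ→ℚ 0) (I-resp (sym (ℚP.+-identityʳ t)) t∈ₚ)))
      in I⇒Cong (L a) ((1ℚ + inv t) * S a - (- 1ℚ) ^ r * inv t)
           (large-residue r a∈′ t∈ i∈ r<p r>h a≡r+Pt t*i≡1))
  , (λ r>h t≡0 → I⇒Cong (L a) ((- 1ℚ) ^ r - P * eulerPoly M (- a))
      (large-residue-0 r a∈′ r<p r>h
        (I-resp (sym a-r≡Pt) (I-* I-P (I-resp (ℚP.+-identityʳ t) (Cong⇒I t (ℕ→ℚ 0) t≡0))))))
  where
  open Localization p pp
  -- Since `p` is matched as `suc (suc M)`, `p ∸ 1` and `p ∸ 2` compute to N and M.
  open Congruences p (suc M) (suc M ℕ./ 2) M pp refl (prime-odd (suc M) pp (ℕP.<⇒≤ 3<p)) refl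
  a∈′ : I 0 a
  a∈′ = Zp⇒I a∈
  t : ℚ
  t = (a - ℕ→ℚ r) * inv P
  a-r≡Pt : a - ℕ→ℚ r ≡ P * t
  a-r≡Pt = sym (trans (lemma P (a - ℕ→ℚ r) (inv P))
    (trans (cong ((a - ℕ→ℚ r) *_) (*-inv P P≢0)) (ℚP.*-identityʳ (a - ℕ→ℚ r))))
    where
    lemma : ∀ q x i → q * (x * i) ≡ x * (q * i)
    lemma = solve-∀ ring
  a≡r+Pt : a ≡ ℕ→ℚ r + P * t
  a≡r+Pt = trans (lemma a (ℕ→ℚ r)) (cong (ℕ→ℚ r +_) a-r≡Pt)
    where
    lemma : ∀ a r → a ≡ r + (a - r)
    lemma = solve-∀ ring
  -- The quotient witnessing a ≡ r modulo p can only be t; this is the source of the integrality of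
  -- t.
  t≡z : t ≡ z
  t≡z = trans (cong (_* inv P) a-r≡) (trans (lemma P z (inv P))
    (trans (cong (z *_) (*-inv P P≢0)) (ℚP.*-identityʳ z)))
    where
    lemma : ∀ q z i → q * 1ℚ * z * i ≡ z * (q * i)
    lemma = solve-∀ ring
  t∈ : I 0 t
  t∈ = I-resp (sym t≡z) (Zp⇒I z∈)
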